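{- There is an online algorithm for the online Steiner forest problem (in the terminal-metric model described in the context) such that, over any sequence of $n$ arrivals of terminal pairs $(u_t,v_t)$, after every arrival $t$ the maintained edge set $F^{(t)}$ is a feasible Steiner forest solution for the first $t$ pairs whose cost is at most $O(1)$ times the optimal cost for the first $t$ pairs, and the total number of edge insertions and deletions performed over all $n$ arrivals is at most $O(n\log n)$. (The constants hidden in $O(\cdot)$ are absolute.)
   Context: Online Steiner forest in the terminal-metric model: there is a metric $\mathcal{M}$ on a terminal set $V=\{u_i,v_i : 1\le i\le n\}$ with all pairwise distances at least $1$, and each terminal belongs to exactly one demand pair $(u_i,v_i)$. The metric is viewed as the complete graph on $V$ where edge $(x,y)$ has cost equal to the distance between $x$ and $y$. At arrival $t$, the pair $(u_t,v_t)$ arrives and the distances between the new terminals and all previously arrived terminals are revealed; thus after arrival $t$ only the submetric $\mathcal{M}^{(t)}$ induced by the arrived terminals $V^{(t)}$ and the arrived pairs $D^{(t)}$ are known. A feasible solution for $(\mathcal{M}^{(t)},D^{(t)})$ is a set $F$ of edges of the complete graph on $V^{(t)}$ in which each arrived pair $(u,v)$ is connected; its cost is the sum of its edge costs. After each arrival the algorithm outputs a feasible solution $F^{(t)}$; the recourse is the total number of edges inserted and deleted when going from $F^{(t-1)}$ to $F^{(t)}$, summed over all $t$ (with $F^{(0)}=\emptyset$). The solution is $\alpha$-competitive if each $F^{(t)}$ has cost at most $\alpha$ times the optimal cost for $(\mathcal{M}^{(t)},D^{(t)})$.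
   Formalization: The metric on the terminals is taken to have rational distances, whereas the statement allows arbitrary real distances. -}

module Defs where

open import Data.Bool using (Bool; true; false; if_then_else_; _xor_)
open import Data.Nat as ℕ using (ℕ; zero; suc; _<ᵇ_) renaming (_+_ to _+ℕ_; _*_ to _*ℕ_)
open import Data.Bool using (_∧_)
open import Data.Integer using (+_)
open import Data.Rational using (ℚ; 0ℚ; 1ℚ; _+_; _*_; _≤_; _/_)
open import Data.Product using (_×_)
open import Data.Sum using (_⊎_)
open import Relation.Binary.PropositionalEquality using (_≡_; _≢_)

-- Terminal encoding: pair i (0-based) consists of terminals u_i = 2i and v_i = 2i+1.
-- After t arrivals the arrived terminals are 0 .. 2t-1.

-- A distance function on terminals (only values on arrived terminals matter).
Dist : Set
Dist = ℕ → ℕ → ℚ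

-- An edge set: the unordered edge {x,y} with x < y is present iff E x y ≡ true.
-- Entries with x ≥ y, or with endpoints not arrived, are ignored.
EdgeSet : Set
EdgeSet = ℕ → ℕ → Bool

inRange : ℕ → ℕ → ℕ → Bool
inRange t x y = (x <ᵇ y) ∧ (y <ᵇ (2 *ℕ t))

edgeAt : ℕ → EdgeSet → ℕ → ℕ → Bool
edgeAt t E x y = inRange t x y ∧ E x y

sumℕ : ℕ → (ℕ → ℕ) → ℕ
sumℕ zero    f = 0
sumℕ (suc k) f = sumℕ k f +ℕ f k

sumℚ : ℕ → (ℕ → ℚ) → ℚ
sumℚ zero    f = 0ℚ
sumℚ (suc k) f = sumℚ k f + f k

cost : Dist → ℕ → EdgeSet → ℚ
cost d t E = sumℚ (2 *ℕ t) λ y → sumℚ y λ x → if edgeAt t E x y then d x y else 0ℚ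

Adj : ℕ → EdgeSet → ℕ → ℕ → Set
Adj t E a b = (edgeAt t E a b ≡ true) ⊎ (edgeAt t E b a ≡ true)

data Conn (t : ℕ) (E : EdgeSet) (a : ℕ) : ℕ → Set where
  here : Conn t E a a
  step : ∀ {b c} → Conn t E a b → Adj t E b c → Conn t E a c

Feasible : ℕ → EdgeSet → Set
Feasible t E = ∀ i → i ℕ.< t → Conn t E (2 *ℕ i) (suc (2 *ℕ i))

IsTerminalMetric : ℕ → Dist → Set
IsTerminalMetric n d =
  (∀ x → x ℕ.< 2 *ℕ n → d x x ≡ 0ℚ) ×
  (∀ x y → x ℕ.< 2 *ℕ n → y ℕ.< 2 *ℕ n → d x y ≡ d y x) ×
  (∀ x y z → x ℕ.< 2 *ℕ n → y ℕ.< 2 *ℕ n → z ℕ.< 2 *ℕ n → d x z ≤ d x y + d y z) ×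
  (∀ x y → x ℕ.< 2 *ℕ n → y ℕ.< 2 *ℕ n → x ≢ y → 1ℚ ≤ d x y)

reveal : ℕ → Dist → Dist
reveal t d x y = if (x <ᵇ (2 *ℕ t)) ∧ (y <ᵇ (2 *ℕ t)) then d x y else 0ℚ

-- A deterministic online algorithm: after arrival t it outputs F^{(t)} as a function
-- of t and the revealed submetric M^{(t)} only (this is the whole input history).
OnlineAlg : Set
OnlineAlg = ℕ → Dist → EdgeSet

run : OnlineAlg → Dist → ℕ → EdgeSet
run A d zero    = λ _ _ → false
run A d (suc t) = A (suc t) (reveal (suc t) d)

changes : OnlineAlg → Dist → ℕ → ℕ
changes A d s = sumℕ (2 *ℕ suc s) λ y → sumℕ y λ x →
  if edgeAt s (run A d s) x y xor edgeAt (suc s) (run A d (suc s)) x y then 1 else 0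

recourse : OnlineAlg → Dist → ℕ → ℕ
recourse A d n = sumℕ n (changes A d)

_·_ : ℕ → ℚ → ℚ
α · q = ((+ α) / 1) * q

{-# OPTIONS --safe #-}

-- Distances are rounded up to integers, which at most doubles them. Time is cut into phases during which
-- the optimum stays below twice its value ref at the start of the phase, and the pairs of a phase are served
-- by edges between terminals of that phase alone: shortcutting tours shows that this costs only a constant
-- factor, and the costs of the phases form a geometric series because ref doubles.
--
-- In a phase, an arriving pair u, v is joined by the cheapest detour u–w, w′–v through an already connected
-- pair w, w′ (possibly by the edge u–v). If its cost is about 2^j, each of u and v is hooked to a center of
-- scale j closer than 2^j / 2, or becomes such a center itself. Once the cost bought since the last
-- recomputation exceeds ref, the solution of the phase is replaced by an optimal one for its pairs and hooks.
-- Hooks are shorter than the demands at both of their ends, so keeping them costs only a constant factor.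
--
-- An arrival of scale j creates a center or, if both ends are near centers, merges two components containing
-- centers (otherwise the detour through these centers would be cheaper than 2^j). Hence there are at most
-- twice as many such arrivals as centers, and since every solution leaves the disjoint balls of radius about
-- 2^j around the centers, each scale contributes O(ref) to the cost bought in the phase. With m arrivals only
-- about log m scales matter, so there are O(log m) recomputations, each changing O(m) edges.
module Submission where

open import Defs
open import Data.Nat using (ℕ; zero; suc; _+_; _*_; _∸_; _^_; _≤_; _<_; _<ᵇ_; z≤n; s≤s; _⊓_; _⊔_; ∣_-_∣; ⌊_/2⌋; >-nonZero)
open import Data.Nat.Properties
open import Data.Nat.DivMod using (_/_; m≡m%n+[m/n]*n; m%n<n; m<n*o⇒m/o<n)
open import Data.Nat.Coprimality using (1-coprimeTo)
import Data.Nat.Coprimality as Coprime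
open import Data.Nat.Induction using (<-rec)
open import Data.Nat.Logarithm using (⌊log₂_⌋; ⌊log₂⌋-mono-≤; ⌊log₂⌊n/2⌋⌋≡⌊log₂n⌋∸1)
open import Data.Nat.Tactic.RingSolver using (solve-∀)
open import Data.Integer.Base as ℤ using (-[1+_]) renaming (+_ to posℤ)
import Data.Integer.Properties as ℤ
open import Data.Rational using () renaming (_≤_ to _≤ℚ_)
open import Data.Rational.Base as ℚ using (ℚ; mkℚ; 0ℚ; 1ℚ)
import Data.Rational.Properties as ℚ
import Data.Rational.Unnormalised.Base as ℚᵘ
import Data.Rational.Unnormalised.Properties as ℚᵘ
open import Data.Bool.Base using (Bool; true; false; if_then_else_; _∧_; _∨_; _xor_)
import Data.Bool.Base as 𝔹
open import Data.Empty using (⊥-elim)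
open import Data.List.Base using (List; []; _∷_; _++_; [_]; map; concatMap; filter; length; downFrom; cartesianProduct; cartesianProductWith)
open import Data.List.Properties using (++-assoc; ++-identityʳ; filter-++; filter-accept; filter-reject; length-++; length-filter; length-downFrom)
import Data.List.Membership.DecPropositional as DecMembership
open import Data.List.Membership.Propositional using (_∈_)
open import Data.List.Membership.Propositional.Properties
open import Data.List.Relation.Unary.All using (All; []; _∷_)
import Data.List.Relation.Unary.All as All
import Data.List.Relation.Unary.All.Properties as All
open import Data.List.Relation.Unary.AllPairs using (AllPairs; []; _∷_)
open import Data.List.Relation.Unary.Any using (here; there)
open import Data.List.Relation.Binary.Permutation.Propositional using (_↭_; ↭-refl; ↭-sym; ↭-trans; ↭-reflexive; prep; swap)
import Data.List.Relation.Binary.Permutation.Propositional as Perm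
open import Data.List.Relation.Binary.Permutation.Propositional.Properties as ↭
  using (∈-resp-↭; shift; ++-comm; ↭-length; filter-↭)
open import Data.Maybe.Base using (Maybe; just; nothing)
open import Data.Product using (Σ; ∃₂; _×_; _,_; proj₁; proj₂; ∃-syntax)
open import Data.Product.Properties using (≡-dec)
open import Data.Sum.Base using (_⊎_; inj₁; inj₂)
open import Algebra.Bundles using (CommutativeMonoid)
open import Function.Base using (_∘_)
open import Level using (0ℓ)
open import Relation.Nullary using (¬_; Dec; yes; no; does)
open import Relation.Nullary.Decidable using (_⊎-dec_)
open import Relation.Unary using (Pred; Decidable)
open import Relation.Binary.Definitions using (tri<; tri≈; tri>)
open import Relation.Binary.Structures using (IsEquivalence)
open import Relation.Binary.PropositionalEquality
  using (_≡_; _≢_; refl; sym; trans; cong; cong₂; subst; subst₂; module ≡-Reasoning)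

-- Sums, minima and connectivity

-- Proves x ≤ y from A ≤ B: the ring identity carries the arithmetic, s is the slack.
linear : ∀ {A B x y} s → A ≤ B → x + B + s ≡ y + A → x ≤ y
linear {A} {B} {x} {y} s A≤B eq = +-cancelʳ-≤ B x y (begin
  x + B     ≤⟨ m≤m+n (x + B) s ⟩
  x + B + s ≡⟨ eq ⟩
  y + A     ≤⟨ +-monoʳ-≤ y A≤B ⟩
  y + B     ∎)
  where open ≤-Reasoning

-- Unlike if does d then _ else _, it stays stuck on d, so that with-abstraction can find d.
decide : ∀ {p a} {P : Set p} {A : Set a} → Dec P → A → A → A
decide (yes _) x y = x
decide (no _)  x y = y

∑ : ∀ {a} {A : Set a} → (A → ℕ) → List A → ℕ
∑ f []       = 0
∑ f (x ∷ xs) = f x + ∑ f xs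

module _ {a} {A : Set a} where

  ∑-++ : ∀ (f : A → ℕ) xs {ys} → ∑ f (xs ++ ys) ≡ ∑ f xs + ∑ f ys
  ∑-++ f []       = refl
  ∑-++ f (x ∷ xs) = trans (cong (f x +_) (∑-++ f xs)) (sym (+-assoc (f x) _ _))

  ∑-mono : ∀ {f g : A → ℕ} xs → (∀ {x} → x ∈ xs → f x ≤ g x) → ∑ f xs ≤ ∑ g xs
  ∑-mono []       f≤g = z≤n
  ∑-mono (x ∷ xs) f≤g = +-mono-≤ (f≤g (here refl)) (∑-mono xs (f≤g ∘ there))

  ∑-cong : ∀ {f g : A → ℕ} xs → (∀ {x} → x ∈ xs → f x ≡ g x) → ∑ f xs ≡ ∑ g xs
  ∑-cong []       f≡g = refl
  ∑-cong (x ∷ xs) f≡g = cong₂ _+_ (f≡g (here refl)) (∑-cong xs (f≡g ∘ there))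

  ∑-∈ : ∀ (f : A → ℕ) {x xs} → x ∈ xs → f x ≤ ∑ f xs
  ∑-∈ f (here refl) = m≤m+n _ _
  ∑-∈ f (there {y} x∈) = ≤-trans (∑-∈ f x∈) (m≤n+m _ (f y))

  ∑-const : ∀ c (xs : List A) → ∑ (λ _ → c) xs ≡ length xs * c
  ∑-const c []       = refl
  ∑-const c (x ∷ xs) = cong (c +_) (∑-const c xs)

  ∑-+ : ∀ (f g : A → ℕ) xs → ∑ (λ x → f x + g x) xs ≡ ∑ f xs + ∑ g xs
  ∑-+ f g []       = refl
  ∑-+ f g (x ∷ xs) rewrite ∑-+ f g xs = lemma (f x) (g x) (∑ f xs) (∑ g xs)
    where lemma : ∀ a b c d → a + b + (c + d) ≡ a + c + (b + d)
          lemma = solve-∀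

  ∑-0 : ∀ (xs : List A) → ∑ (λ _ → 0) xs ≡ 0
  ∑-0 []       = refl
  ∑-0 (x ∷ xs) = ∑-0 xs

  cheaper : (A → ℕ) → A → A → A
  cheaper c x y = decide (c x ≤? c y) x y

  minBy : (A → ℕ) → A → List A → A
  minBy c d []       = d
  minBy c d (x ∷ xs) = cheaper c x (minBy c d xs)

  minBy-∈ : ∀ (c : A → ℕ) d xs → minBy c d xs ∈ d ∷ xs
  minBy-∈ c d []       = here refl
  minBy-∈ c d (x ∷ xs) with c x ≤? c (minBy c d xs)
  ... | yes _ = there (here refl)
  ... | no  _ with minBy-∈ c d xs
  ...   | here eq  = here eq
  ...   | there m∈ = there (there m∈)

  minBy-≤ : ∀ (c : A → ℕ) d xs {x} → x ∈ d ∷ xs → c (minBy c d xs) ≤ c x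
  minBy-≤ c d []       (here refl) = ≤-refl
  minBy-≤ c d (y ∷ xs) x∈ with c y ≤? c (minBy c d xs) | x∈
  ... | yes p | here refl         = ≤-trans p (minBy-≤ c d xs (here refl))
  ... | yes p | there (here refl) = ≤-refl
  ... | yes p | there (there x∈′) = ≤-trans p (minBy-≤ c d xs (there x∈′))
  ... | no ¬p | here refl         = minBy-≤ c d xs (here refl)
  ... | no ¬p | there (here refl) = <⇒≤ (≰⇒> ¬p)
  ... | no ¬p | there (there x∈′) = minBy-≤ c d xs (there x∈′)

  minBy-cong : ∀ {c c′ : A → ℕ} d xs → (∀ {x} → x ∈ d ∷ xs → c x ≡ c′ x) → minBy c d xs ≡ minBy c′ d xs
  minBy-cong d []       c≡ = refl
  minBy-cong {c} {c′} d (x ∷ xs) c≡ = trans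
    (cong₂ (λ p q → decide (p ≤? q) x (minBy c d xs))
      (c≡ (there (here refl))) (c≡ (weaken (minBy-∈ c d xs))))
    (cong (cheaper c′ x) (minBy-cong d xs (c≡ ∘ weaken)))
    where
    weaken : ∀ {y} → y ∈ d ∷ xs → y ∈ d ∷ x ∷ xs
    weaken (here p)  = here p
    weaken (there p) = there (there p)

  listsUpTo : ℕ → List A → List (List A)
  listsUpTo zero    xs = [ [] ]
  listsUpTo (suc k) xs = [] ∷ cartesianProductWith _∷_ xs (listsUpTo k xs)

  ∈-listsUpTo⁺ : ∀ k {xs l} → All (_∈ xs) l → length l ≤ k → l ∈ listsUpTo k xs
  ∈-listsUpTo⁺ zero    []        _        = here refl
  ∈-listsUpTo⁺ (suc k) []        _        = here refl
  ∈-listsUpTo⁺ (suc k) (x∈ ∷ l∈) (s≤s le) =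
    there (∈-cartesianProductWith⁺ _∷_ x∈ (∈-listsUpTo⁺ k l∈ le))

  ∈-listsUpTo⁻ : ∀ k {xs l} → l ∈ listsUpTo k xs → All (_∈ xs) l × length l ≤ k
  ∈-listsUpTo⁻ zero    (here refl) = [] , z≤n
  ∈-listsUpTo⁻ (suc k) (here refl) = [] , z≤n
  ∈-listsUpTo⁻ (suc k) {xs} (there l∈)
    with _ , _ , x∈ , l′∈ , refl ← ∈-cartesianProductWith⁻ _∷_ xs (listsUpTo k xs) l∈
    = let l⊆ , le = ∈-listsUpTo⁻ k l′∈ in x∈ ∷ l⊆ , s≤s le

∑-swap : ∀ {a b} {A : Set a} {B : Set b} (f : A → B → ℕ) xs ys →
         ∑ (λ x → ∑ (f x) ys) xs ≡ ∑ (λ y → ∑ (λ x → f x y) xs) ys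
∑-swap f []       ys = sym (∑-0 ys)
∑-swap f (x ∷ xs) ys = trans (cong (∑ (f x) ys +_) (∑-swap f xs ys)) (sym (∑-+ (f x) _ ys))

Edge : Set
Edge = ℕ × ℕ

-- Union-find: the label of a vertex is a vertex of its component.
lab : List Edge → ℕ → ℕ
lab []            z = z
lab ((a , b) ∷ E) z = decide (lab E z ≟ lab E b) (lab E a) (lab E z)

lab-edge : ∀ {a b E} → (a , b) ∈ E → lab E a ≡ lab E b
lab-edge {a} {b} {_ ∷ E} (here refl) with lab E b ≟ lab E b | lab E a ≟ lab E b
... | yes _ | yes _ = refl
... | yes _ | no _  = refl
... | no ¬p | _     = ⊥-elim (¬p refl)
lab-edge {E = (a , b) ∷ E} (there e∈) =
  cong (λ l → decide (l ≟ lab E b) (lab E a) l) (lab-edge e∈)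

module _ {ℓ} {R : ℕ → ℕ → Set ℓ} (eq : IsEquivalence R) where
  private module R = IsEquivalence eq

  -- The label of a vertex is reached from it along edges, so every equivalence containing the edges
  -- relates the two. Equality of labels is thus the least such equivalence, and `lab-least` carries
  -- it over to any other notion of connectivity.
  lab-rep : ∀ {E} → (∀ {a b} → (a , b) ∈ E → R a b) → ∀ z → R (lab E z) z
  lab-rep {[]}          edge z = R.refl
  lab-rep {(a , b) ∷ E} edge z with lab E z ≟ lab E b
  ... | no _  = lab-rep (edge ∘ there) z
  ... | yes p = R.trans (lab-rep (edge ∘ there) a) (R.trans (edge (here refl))
                  (R.trans (R.sym (lab-rep (edge ∘ there) b))
                  (R.trans (R.reflexive (sym p)) (lab-rep (edge ∘ there) z))))

  lab-least : ∀ {E} → (∀ {a b} → (a , b) ∈ E → R a b) → ∀ {x y} → lab E x ≡ lab E y → R x y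
  lab-least {E} edge {x} {y} p =
    R.trans (R.sym (lab-rep {E} edge x)) (R.trans (R.reflexive p) (lab-rep edge y))

sameLabel : ∀ E → IsEquivalence (λ x y → lab E x ≡ lab E y)
sameLabel E = record { refl = refl ; sym = sym ; trans = trans }

lab-⊆ : ∀ {E E′} → (∀ {p} → p ∈ E → p ∈ E′) → ∀ {x y} → lab E x ≡ lab E y → lab E′ x ≡ lab E′ y
lab-⊆ {E} {E′} E⊆E′ = lab-least (sameLabel E′) {E} (lab-edge ∘ E⊆E′)

-- Closed tours through components

∑-↭ : ∀ {a} {A : Set a} (f : A → ℕ) {xs ys} → xs ↭ ys → ∑ f xs ≡ ∑ f ys
∑-↭ f Perm.refl         = refl
∑-↭ f (prep x p)        = cong (f x +_) (∑-↭ f p)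
∑-↭ f {xs = _ ∷ _ ∷ xs} (swap x y p) rewrite sym (∑-↭ f p) = lemma (f x) (f y) (∑ f xs)
  where lemma : ∀ a b c → a + (b + c) ≡ b + (a + c)
        lemma = solve-∀
∑-↭ f (Perm.trans p q)  = trans (∑-↭ f p) (∑-↭ f q)

concatMap-↭ : ∀ {a b} {A : Set a} {B : Set b} (f : A → List B) {xs ys} → xs ↭ ys → concatMap f xs ↭ concatMap f ys
concatMap-↭ f Perm.refl        = ↭-refl
concatMap-↭ f (prep x p)       = ↭.++⁺ˡ (f x) (concatMap-↭ f p)
concatMap-↭ f (swap x y p) =
  ↭-trans (↭.shifts (f x) (f y)) (↭.++⁺ˡ (f y) (↭.++⁺ˡ (f x) (concatMap-↭ f p)))
concatMap-↭ f (Perm.trans p q) = ↭-trans (concatMap-↭ f p) (concatMap-↭ f q)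

∈⇒↭ : ∀ {a} {A : Set a} {x : A} {xs} → x ∈ xs → ∃[ ys ] xs ↭ x ∷ ys
∈⇒↭ x∈ with ys , zs , refl ← ∈-∃++ x∈ = ys ++ zs , shift _ ys zs

module Tours (e : ℕ → ℕ → ℕ)
             (e-refl : ∀ x → e x x ≡ 0)
             (e-sym : ∀ x y → e x y ≡ e y x)
             (e-tri : ∀ x y z → e x z ≤ e x y + e y z) where

  walk : ℕ → List ℕ → ℕ → ℕ
  walk x []      z = e x z
  walk x (y ∷ l) z = e x y + walk y l z

  closed : List ℕ → ℕ
  closed []      = 0
  closed (x ∷ l) = walk x l x

  walk-++ : ∀ x l y l′ z → walk x (l ++ y ∷ l′) z ≡ walk x l y + walk y l′ z
  walk-++ x []      y l′ z = refl
  walk-++ x (w ∷ l) y l′ z =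
    trans (cong (e x w +_) (walk-++ w l y l′ z)) (sym (+-assoc (e x w) _ _))

  walk-redirect : ∀ x l y z → walk x l z ≤ walk x l y + e y z
  walk-redirect x []      y z = e-tri x y z
  walk-redirect x (w ∷ l) y z =
    ≤-trans (+-monoʳ-≤ (e x w) (walk-redirect w l y z)) (≤-reflexive (sym (+-assoc (e x w) _ _)))

  walk-skip : ∀ x y l z → walk x l z ≤ e x y + walk y l z
  walk-skip x y []      z = e-tri x y z
  walk-skip x y (w ∷ l) z =
    ≤-trans (+-monoˡ-≤ (walk w l z) (e-tri x y w)) (≤-reflexive (+-assoc (e x y) (e y w) _))

  e≤walk : ∀ x l z → e x z ≤ walk x l z
  e≤walk x []      z = ≤-refl
  e≤walk x (y ∷ l) z = ≤-trans (e-tri x y z) (+-monoʳ-≤ (e x y) (e≤walk y l z))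

  -- A tour is a cyclic sequence; moving its cut point to an end of a new edge prepares it for being
  -- spliced with another tour there.
  rotate : ∀ {a C} → a ∈ C → ∃[ r ] C ↭ a ∷ r × walk a r a ≡ closed C
  rotate {a} a∈ with ∈-∃++ a∈
  ... | []     , ys , refl = ys , ↭-refl , refl
  ... | x ∷ xs , ys , refl = ys ++ x ∷ xs , ++-comm (x ∷ xs) (a ∷ ys) ,
    trans (walk-++ a ys x xs a) (trans (+-comm (walk a ys x) _) (sym (walk-++ x xs a ys x)))

  e≤closed : ∀ {x y C} → x ∈ C → y ∈ C → e x y ≤ closed C
  e≤closed {x} {y} {C} x∈ y∈ with r , C↭ , eq ← rotate x∈ with ∈-resp-↭ C↭ y∈
  ... | here refl = ≤-trans (≤-reflexive (e-refl x)) z≤n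
  ... | there y∈r with l , l′ , refl ← ∈-∃++ y∈r = begin
    e x y                    ≤⟨ e≤walk x l y ⟩
    walk x l y               ≤⟨ m≤m+n _ _ ⟩
    walk x l y + walk y l′ x ≡⟨ walk-++ x l y l′ x ⟨
    walk x (l ++ y ∷ l′) x   ≡⟨ eq ⟩
    closed C                 ∎
    where open ≤-Reasoning

  -- A closed tour through a component together with a budget dominating the demand widths in it.
  Comp : Set
  Comp = List ℕ × ℕ

  weight : Comp → ℕ
  weight (C , m) = closed C + m

  -- The tours partition `V`. A class of labels has to lie inside one tour, but a tour may hold
  -- several classes; this one-sided condition is what survives in `refine`.
  record Touring (V : List ℕ) (W L : ℕ → ℕ) (S : List Comp) : Set where
    constructor touring
    field
      vertices : concatMap proj₁ S ↭ V
      class    : ∀ {x} → x ∈ V → ∃[ c ] c ∈ S ×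
                 (∀ {y} → y ∈ V → L y ≡ L x → y ∈ proj₁ c × W y ≤ proj₂ c)

  open Touring

  refine : ∀ {V W L L′ S} → (∀ x y → L′ x ≡ L′ y → L x ≡ L y) → Touring V W L S → Touring V W L′ S
  refine L′⇒L T .vertices = vertices T
  refine L′⇒L T .class x∈ with c , c∈ , cl ← class T x∈ = c , c∈ , λ y∈ eq → cl y∈ (L′⇒L _ _ eq)

  module _ {V : List ℕ} {W L L′ : ℕ → ℕ} {S : List Comp} {a b : ℕ} (a∈V : a ∈ V) (b∈V : b ∈ V)
           (glued : ∀ x y → L′ x ≡ L′ y → L x ≡ L y ⊎ (L x ≡ L a ⊎ L x ≡ L b) × (L y ≡ L a ⊎ L y ≡ L b))
           (T : Touring V W L S) where
    private
      Ends : ℕ → Set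
      Ends x = L x ≡ L a ⊎ L x ≡ L b

      ends? : ∀ x → Dec (Ends x)
      ends? x = (L x ≟ L a) ⊎-dec (L x ≟ L b)

      Class : List Comp → ℕ → Set
      Class S x = ∃[ c ] c ∈ S × (∀ {y} → y ∈ V → L′ y ≡ L′ x → y ∈ proj₁ c × W y ≤ proj₂ c)

      ends-closed : ∀ x y → Ends x → L′ y ≡ L′ x → Ends y
      ends-closed x y ends eq with glued y x eq
      ... | inj₂ (ends′ , _) = ends′
      ... | inj₁ y≡x with ends
      ...   | inj₁ x≡a = inj₁ (trans y≡x x≡a)
      ...   | inj₂ x≡b = inj₂ (trans y≡x x≡b)

      inner : ∀ x y → ¬ Ends x → L′ y ≡ L′ x → L y ≡ L x
      inner x y ¬ends eq with glued y x eq
      ... | inj₁ y≡x         = y≡x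
      ... | inj₂ (_ , ends)  = ⊥-elim (¬ends ends)

      budget : ∀ {k m n} → k ≤ m → k ≤ n → k + (m ⊔ n) ≤ m + n
      budget {k} {m} {n} k≤m k≤n with ≤-total m n
      ... | inj₁ m≤n rewrite m≤n⇒m⊔n≡n m≤n = +-monoˡ-≤ n k≤m
      ... | inj₂ n≤m rewrite m≥n⇒m⊔n≡m n≤m = ≤-trans (+-monoˡ-≤ m k≤n) (≤-reflexive (+-comm n m))

    -- The two tours, rotated to the ends of the edge, are spliced by walking the edge twice. The
    -- merged tour keeps the larger of the two budgets, so the smaller one is freed; when both ends
    -- are wide enough, it pays for the doubled edge and the weight does not grow.
    join : ∃[ S′ ] Touring V W L′ S′ × ∑ weight S′ ≤ ∑ weight S + 2 * e a b
                   × (2 * e a b ≤ W a → 2 * e a b ≤ W b → ∑ weight S′ ≤ ∑ weight S)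
    join
      with (A , ma) , A∈S , clA ← class T a∈V | (B , mb) , B∈S , clB ← class T b∈V
      with R , S↭ ← ∈⇒↭ A∈S
      with ∈-resp-↭ S↭ B∈S
    -- Both ends already lie on one tour, which therefore contains the merged class.
    ... | here refl = S , touring (vertices T) cl , m≤m+n _ _ , λ _ _ → ≤-refl
      where
      clEnds : ∀ {y} → y ∈ V → Ends y → y ∈ A × W y ≤ ma
      clEnds y∈V (inj₁ y≡a) = clA y∈V y≡a
      clEnds y∈V (inj₂ y≡b) = clB y∈V y≡b
      cl : ∀ {x} → x ∈ V → Class S x
      cl {x} x∈V with ends? x
      ... | yes ends  = (A , ma) , A∈S , λ {y} y∈V eq → clEnds y∈V (ends-closed x y ends eq)
      ... | no ¬ends  = let c , c∈ , clx = class T x∈V in c , c∈ , λ {y} y∈V eq → clx y∈V (inner x y ¬ends eq)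
    ... | there B∈R
      with R′ , R↭ ← ∈⇒↭ B∈R
      with rA , A↭ , eqA ← rotate (proj₁ (clA a∈V refl)) | rB , B↭ , eqB ← rotate (proj₁ (clB b∈V refl))
      = (M , ma ⊔ mb) ∷ R′ , touring verts cl , growth , shrink
      where
      S↭′ : S ↭ (A , ma) ∷ (B , mb) ∷ R′
      S↭′ = ↭-trans S↭ (prep _ R↭)
      M : List ℕ
      M = a ∷ rA ++ b ∷ rB
      A⊆ : ∀ {y} → y ∈ A → y ∈ M
      A⊆ y∈ = ∈-++⁺ˡ (∈-resp-↭ A↭ y∈)
      B⊆ : ∀ {y} → y ∈ B → y ∈ M
      B⊆ y∈ = ∈-++⁺ʳ (a ∷ rA) (∈-resp-↭ B↭ y∈)
      costM : closed M ≤ closed A + closed B + 2 * e a b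
      costM = begin
        walk a (rA ++ b ∷ rB) a                         ≡⟨ walk-++ a rA b rB a ⟩
        walk a rA b + walk b rB a                       ≤⟨ +-mono-≤ (walk-redirect a rA a b) (walk-redirect b rB b a) ⟩
        (walk a rA a + e a b) + (walk b rB b + e b a)   ≡⟨ cong₂ _+_ (cong (_+ e a b) eqA) (cong₂ _+_ eqB (e-sym b a)) ⟩
        (closed A + e a b) + (closed B + e a b)         ≡⟨ arith (closed A) (closed B) (e a b) ⟩
        closed A + closed B + 2 * e a b                 ∎
        where
        open ≤-Reasoning
        arith : ∀ p q r → (p + r) + (q + r) ≡ p + q + 2 * r
        arith = solve-∀
      total : ∑ weight S ≡ closed A + ma + (closed B + mb + ∑ weight R′)
      total = ∑-↭ weight S↭′
      growth : closed M + (ma ⊔ mb) + ∑ weight R′ ≤ ∑ weight S + 2 * e a b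
      growth rewrite total = linear 0 (+-mono-≤ costM (m⊔n≤m+n ma mb))
        (arith (closed M) (ma ⊔ mb) (∑ weight R′) (closed A) (closed B) (e a b) ma mb)
        where
        arith : ∀ p q r c d x m n → p + q + r + (c + d + 2 * x + (m + n)) + 0
                                    ≡ (c + m + (d + n + r) + 2 * x) + (p + q)
        arith = solve-∀
      shrink : 2 * e a b ≤ W a → 2 * e a b ≤ W b → closed M + (ma ⊔ mb) + ∑ weight R′ ≤ ∑ weight S
      shrink ≤a ≤b rewrite total = linear 0
        (+-mono-≤ costM (budget (≤-trans ≤a (proj₂ (clA a∈V refl))) (≤-trans ≤b (proj₂ (clB b∈V refl)))))
        (arith (closed M) (ma ⊔ mb) (∑ weight R′) (closed A) (closed B) (e a b) ma mb)
        where
        arith : ∀ p q r c d x m n → p + q + r + (c + d + 2 * x + (m + n)) + 0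
                                    ≡ (c + m + (d + n + r)) + (p + (2 * x + q))
        arith = solve-∀
      verts : M ++ concatMap proj₁ R′ ↭ V
      verts = ↭-trans (↭.++⁺ʳ _ (↭.++⁺ (↭-sym A↭) (↭-sym B↭)))
             (↭-trans (↭-reflexive (++-assoc A B _))
             (↭-trans (↭-sym (concatMap-↭ proj₁ S↭′)) (vertices T)))
      clEnds : ∀ {y} → y ∈ V → Ends y → y ∈ M × W y ≤ ma ⊔ mb
      clEnds y∈V (inj₁ y≡a) = let y∈A , Wy = clA y∈V y≡a in A⊆ y∈A , ≤-trans Wy (m≤m⊔n ma mb)
      clEnds y∈V (inj₂ y≡b) = let y∈B , Wy = clB y∈V y≡b in B⊆ y∈B , ≤-trans Wy (m≤n⊔m ma mb)
      cl : ∀ {x} → x ∈ V → Class ((M , ma ⊔ mb) ∷ R′) x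
      cl {x} x∈V with ends? x
      ... | yes ends = _ , here refl , λ {y} y∈V eq → clEnds y∈V (ends-closed x y ends eq)
      ... | no ¬ends with class T x∈V
      ...   | c , c∈ , clx with ∈-resp-↭ S↭′ c∈
      ...     | here refl = _ , here refl , λ {y} y∈V eq →
                  let y∈A , Wy = clx y∈V (inner x y ¬ends eq) in A⊆ y∈A , ≤-trans Wy (m≤m⊔n ma mb)
      ...     | there (here refl) = _ , here refl , λ {y} y∈V eq →
                  let y∈B , Wy = clx y∈V (inner x y ¬ends eq) in B⊆ y∈B , ≤-trans Wy (m≤n⊔m ma mb)
      ...     | there (there c∈R′) = c , there c∈R′ , λ {y} y∈V eq → clx y∈V (inner x y ¬ends eq)

-- Sparse solutions and packings

path : List ℕ → List Edge
path []          = []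
path (x ∷ [])    = []
path (x ∷ y ∷ l) = (x , y) ∷ path (y ∷ l)

length-path : ∀ C → length (path C) ≤ length C
length-path []          = z≤n
length-path (x ∷ [])    = z≤n
length-path (x ∷ y ∷ l) = s≤s (length-path (y ∷ l))

path-⊆ : ∀ C {a b} → (a , b) ∈ path C → a ∈ C × b ∈ C
path-⊆ (x ∷ y ∷ l) (here refl) = here refl , there (here refl)
path-⊆ (x ∷ y ∷ l) (there e∈)  = let a∈ , b∈ = path-⊆ (y ∷ l) e∈ in there a∈ , there b∈

path-connected : ∀ {E} C → (∀ {p} → p ∈ path C → p ∈ E) → ∀ {x y} → x ∈ C → y ∈ C → lab E x ≡ lab E y
path-connected {E} (h ∷ l) path⊆ x∈ y∈ = trans (toHead h l path⊆ x∈) (sym (toHead h l path⊆ y∈))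
  where
  toHead : ∀ h l → (∀ {p} → p ∈ path (h ∷ l) → p ∈ E) → ∀ {x} → x ∈ h ∷ l → lab E x ≡ lab E h
  toHead h l       path⊆ (here refl) = refl
  toHead h (y ∷ l) path⊆ (there x∈)  =
    trans (toHead y l (path⊆ ∘ there) x∈) (sym (lab-edge (path⊆ (here refl))))

-- A new edge only gives the class of `b` the label of `a`, so each new coincidence of labels is
-- between the two end classes. This is the hypothesis `glued` of `join`.
lab-glued : ∀ {a b} E x y → lab ((a , b) ∷ E) x ≡ lab ((a , b) ∷ E) y →
            lab E x ≡ lab E y ⊎ (lab E x ≡ lab E a ⊎ lab E x ≡ lab E b) × (lab E y ≡ lab E a ⊎ lab E y ≡ lab E b)
lab-glued {a} {b} E x y eq with lab E x ≟ lab E b | lab E y ≟ lab E b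
... | yes p | yes q = inj₁ (trans p (sym q))
... | yes p | no _  = inj₂ (inj₂ p , inj₁ (sym eq))
... | no _  | yes q = inj₂ (inj₁ eq , inj₂ q)
... | no _  | no _  = inj₁ eq

lab-idle : ∀ {a b} E → lab E a ≡ lab E b → ∀ x y → lab ((a , b) ∷ E) x ≡ lab ((a , b) ∷ E) y → lab E x ≡ lab E y
lab-idle {a} {b} E a≡b x y eq with lab E x ≟ lab E b | lab E y ≟ lab E b
... | yes p | yes q = trans p (sym q)
... | yes p | no _  = trans p (trans (sym a≡b) eq)
... | no _  | yes q = trans eq (trans a≡b (sym q))
... | no _  | no _  = eq

∣-∣-bound : ∀ m n {d} → m ≤ n + d → n ≤ m + d → ∣ m - n ∣ ≤ d
∣-∣-bound m n m≤ n≤ with ≤-total m n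
... | inj₁ m≤n rewrite m≤n⇒∣m-n∣≡n∸m m≤n = m≤n+o⇒m∸n≤o n m n≤
... | inj₂ n≤m rewrite ∣-∣-comm m n | m≤n⇒∣m-n∣≡n∸m n≤m = m≤n+o⇒m∸n≤o m n m≤

⊓-lipschitz : ∀ {m} n d r → m ≤ n + d → m ⊓ r ≤ n ⊓ r + d
⊓-lipschitz n d r m≤ =
  ≤-trans (⊓-mono-≤ m≤ (m≤m+n r d)) (≤-reflexive (sym (+-distribʳ-⊓ d n r)))

Metric : Set
Metric = ℕ → ℕ → ℕ

len : Metric → Edge → ℕ
len e (a , b) = e a b

price : Metric → List Edge → ℕ
price e = ∑ (len e)

Within : Pred ℕ 0ℓ → List Edge → Set
Within P E = ∀ {a b} → (a , b) ∈ E → P a × P b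

module Forests (e : Metric)
               (e-refl : ∀ x → e x x ≡ 0)
               (e-sym : ∀ x y → e x y ≡ e y x)
               (e-tri : ∀ x y z → e x z ≤ e x y + e y z) where

  open Tours e e-refl e-sym e-tri
  open Touring

  -- Edge doubling: starting from one-vertex tours, an edge is walked twice when it merges two of
  -- them. The widths are zero here; demand widths enter with `tourWithShort`.
  tour : ∀ {V} G → Within (_∈ V) G →
         ∃[ S ] Touring V (λ _ → 0) (lab G) S × ∑ weight S ≤ 2 * price e G
  tour {V} [] G⊆ = map start V , touring (↭-reflexive (flat V)) cl , ≤-reflexive (free V)
    where
    start : ℕ → Comp
    start x = [ x ] , 0
    flat : ∀ xs → concatMap proj₁ (map start xs) ≡ xs
    flat []       = refl
    flat (x ∷ xs) = cong (x ∷_) (flat xs)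
    free : ∀ xs → ∑ weight (map start xs) ≡ 0
    free []       = refl
    free (x ∷ xs) rewrite e-refl x = free xs
    cl : ∀ {x} → x ∈ V → ∃[ c ] c ∈ map start V × (∀ {y} → y ∈ V → y ≡ x → y ∈ proj₁ c × 0 ≤ proj₂ c)
    cl {x} x∈ = start x , ∈-map⁺ start x∈ , λ { _ refl → here refl , z≤n }
  tour {V} ((a , b) ∷ G) G⊆
    with S , T , w ← tour G (G⊆ ∘ there)
    with S′ , T′ , grow , _ ← join (proj₁ (G⊆ (here refl))) (proj₂ (G⊆ (here refl))) (lab-glued G) T
    = S′ , T′ , linear 0 (+-mono-≤ w grow) (arith (∑ weight S) (∑ weight S′) (e a b) (price e G))
    where
    arith : ∀ s s′ x c → s′ + (2 * c + (s + 2 * x)) + 0 ≡ 2 * (x + c) + (s + s′)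
    arith = solve-∀

  -- In each component of G the budget is the length of its tour, hence at least any demand width;
  -- a short edge is paid by the smaller of the two budgets it merges.
  tourWithShort : ∀ {V} (W : ℕ → ℕ) G → Within (_∈ V) G →
    (∀ {y} → y ∈ V → ∃[ p ] p ∈ V × lab G p ≡ lab G y × W y ≤ e y p) →
    ∀ Q → Within (_∈ V) Q →
    (∀ {a b} → (a , b) ∈ Q → lab G a ≡ lab G b ⊎ 2 * e a b ≤ W a × 2 * e a b ≤ W b) →
    ∃[ S ] Touring V W (lab (Q ++ G)) S × ∑ weight S ≤ 4 * price e G
  tourWithShort {V} W G G⊆ partner [] Q⊆ short with S , T , w ← tour G G⊆ =
    map fund S , touring (↭-trans (↭-reflexive (funded S)) (vertices T)) cl ,
    ≤-trans (doubled S) (≤-trans (*-monoʳ-≤ 2 w) (≤-reflexive (sym (*-assoc 2 2 (price e G)))))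
    where
    fund : Comp → Comp
    fund (C , _) = C , closed C
    funded : ∀ S → concatMap proj₁ (map fund S) ≡ concatMap proj₁ S
    funded []      = refl
    funded (c ∷ S) = cong (proj₁ c ++_) (funded S)
    doubled : ∀ S → ∑ weight (map fund S) ≤ 2 * ∑ weight S
    doubled []            = z≤n
    doubled ((C , m) ∷ S) = linear (2 * m) (doubled S) (arith (closed C) m _ _)
      where
      arith : ∀ c m s s′ → c + c + s + 2 * s′ + 2 * m ≡ 2 * (c + m + s′) + s
      arith = solve-∀
    cl : ∀ {x} → x ∈ V → ∃[ c ] c ∈ map fund S × (∀ {y} → y ∈ V → lab G y ≡ lab G x → y ∈ proj₁ c × W y ≤ proj₂ c)
    cl x∈ with c , c∈ , clx ← class T x∈ = fund c , ∈-map⁺ fund c∈ , λ y∈ y≡x →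
      let p , p∈ , p≡y , W≤ = partner y∈
          y∈C = proj₁ (clx y∈ y≡x)
      in y∈C , ≤-trans W≤ (e≤closed y∈C (proj₁ (clx p∈ (trans p≡y y≡x))))
  tourWithShort W G G⊆ partner ((a , b) ∷ Q) Q⊆ short
    with S , T , w ← tourWithShort W G G⊆ partner Q (Q⊆ ∘ there) (short ∘ there)
    with short (here refl)
  ... | inj₁ a≡b = S , refine (lab-idle (Q ++ G) (lab-⊆ {G} (∈-++⁺ʳ Q) a≡b)) T , w
  ... | inj₂ (≤a , ≤b)
    with S′ , T′ , _ , shrink ← join (proj₁ (Q⊆ (here refl))) (proj₂ (Q⊆ (here refl))) (lab-glued (Q ++ G)) T
    = S′ , T′ , ≤-trans (shrink ≤a ≤b) w

  module _ {P : Pred ℕ 0ℓ} (P? : Decidable P) where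

    -- By the triangle inequality, skipping a dropped vertex does not lengthen the walk. The dropped
    -- vertices before the first kept one, and the way back to the start, are simply cut off.
    cost-path-filter : ∀ C → price e (path (filter P? C)) ≤ closed C
    cost-path-filter []      = z≤n
    cost-path-filter (x ∷ l) = head x l x
      where
      onPath : ∀ x l z → price e (path (x ∷ filter P? l)) ≤ walk x l z
      onPath x []      z = z≤n
      onPath x (y ∷ l) z with P? y
      ... | yes _ = +-monoʳ-≤ (e x y) (onPath y l z)
      ... | no _  = ≤-trans (onPath x l z) (walk-skip x y l z)
      head : ∀ x l z → price e (path (filter P? (x ∷ l))) ≤ walk x l z
      head x l z with P? x
      head x l       z | yes _ = onPath x l z
      head x []      z | no _  = z≤n
      head x (y ∷ l) z | no _  = ≤-trans (head y l z) (m≤n+m _ (e x y))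

    shortcut : List Comp → List Edge
    shortcut = concatMap (λ c → path (filter P? (proj₁ c)))

    cost-shortcut : ∀ S → price e (shortcut S) ≤ ∑ weight S
    cost-shortcut []            = z≤n
    cost-shortcut ((C , m) ∷ S) = ≤-trans (≤-reflexive (∑-++ (len e) (path (filter P? C))))
      (+-mono-≤ (≤-trans (cost-path-filter C) (m≤m+n _ m)) (cost-shortcut S))

    length-shortcut : ∀ S → length (shortcut S) ≤ length (filter P? (concatMap proj₁ S))
    length-shortcut []            = z≤n
    length-shortcut ((C , m) ∷ S) = begin
      length (path (filter P? C) ++ shortcut S)                        ≡⟨ length-++ (path (filter P? C)) ⟩
      length (path (filter P? C)) + length (shortcut S)                ≤⟨ +-mono-≤ (length-path (filter P? C)) (length-shortcut S) ⟩
      length (filter P? C) + length (filter P? (concatMap proj₁ S))    ≡⟨ length-++ (filter P? C) ⟨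
      length (filter P? C ++ filter P? (concatMap proj₁ S))            ≡⟨ cong length (filter-++ P? C _) ⟨
      length (filter P? (C ++ concatMap proj₁ S))                      ∎
      where open ≤-Reasoning

    shortcut-within : ∀ S → Within (_∈ filter P? (concatMap proj₁ S)) (shortcut S)
    shortcut-within ((C , m) ∷ S) e∈ rewrite filter-++ P? C (concatMap proj₁ S)
      with ∈-++⁻ (path (filter P? C)) e∈
    ... | inj₁ e∈C = let a∈ , b∈ = path-⊆ _ e∈C in ∈-++⁺ˡ a∈ , ∈-++⁺ˡ b∈
    ... | inj₂ e∈S = let a∈ , b∈ = shortcut-within S e∈S in ∈-++⁺ʳ _ a∈ , ∈-++⁺ʳ _ b∈

    shortcut-⊇ : ∀ {c} S → c ∈ S → ∀ {p} → p ∈ path (filter P? (proj₁ c)) → p ∈ shortcut S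
    shortcut-⊇ (_ ∷ S) (here refl) p∈ = ∈-++⁺ˡ p∈
    shortcut-⊇ (_ ∷ S) (there c∈)  p∈ = ∈-++⁺ʳ _ (shortcut-⊇ S c∈ p∈)

  -- The tours of `tourWithShort` are shortcut to the selected vertices and opened into paths. A
  -- solution using arbitrary vertices thus becomes one on the selected vertices alone, at a
  -- constant factor, and with few enough edges to be found by the search in `best`.
  sparsify : ∀ {V} (W : ℕ → ℕ) G → Within (_∈ V) G →
    (∀ {y} → y ∈ V → ∃[ p ] p ∈ V × lab G p ≡ lab G y × W y ≤ e y p) →
    ∀ Q → Within (_∈ V) Q →
    (∀ {a b} → (a , b) ∈ Q → lab G a ≡ lab G b ⊎ 2 * e a b ≤ W a × 2 * e a b ≤ W b) →
    ∀ {P : Pred ℕ 0ℓ} (P? : Decidable P) →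
    ∃[ E ] Within (_∈ filter P? V) E × length E ≤ length (filter P? V) × price e E ≤ 4 * price e G
           × (∀ {x y} → x ∈ V → y ∈ V → P x → P y → lab (Q ++ G) x ≡ lab (Q ++ G) y → lab E x ≡ lab E y)
  sparsify W G G⊆ partner Q Q⊆ short P?
    with S , T , w ← tourWithShort W G G⊆ partner Q Q⊆ short
    = shortcut P? S
    , (λ e∈ → let a∈ , b∈ = shortcut-within P? S e∈ in ∈-resp-↭ kept a∈ , ∈-resp-↭ kept b∈)
    , ≤-trans (length-shortcut P? S) (≤-reflexive (↭-length kept))
    , ≤-trans (cost-shortcut P? S) w
    , λ x∈ y∈ Px Py x≡y → let c , c∈ , cl = class T x∈ in
        path-connected (filter P? (proj₁ c)) (shortcut-⊇ P? S c∈)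
          (∈-filter⁺ P? (proj₁ (cl x∈ refl)) Px) (∈-filter⁺ P? (proj₁ (cl y∈ (sym x≡y))) Py)
    where kept = filter-↭ P? (vertices T)

  connected⇒close : ∀ {V} G → Within (_∈ V) G → ∀ {x y} → x ∈ V → y ∈ V → lab G x ≡ lab G y → e x y ≤ 2 * price e G
  connected⇒close G G⊆ x∈ y∈ x≡y
    with S , T , w ← tour G G⊆
    with c , c∈ , cl ← class T x∈
    = ≤-trans (e≤closed (proj₁ (cl x∈ refl)) (proj₁ (cl y∈ (sym x≡y))))
        (≤-trans (m≤m+n _ (proj₂ c)) (≤-trans (∑-∈ weight c∈) w))

  module Packing (r : ℕ) where

    -- Distance from a center, truncated at the radius of its ball; both scaled by 4.
    ball : ℕ → ℕ → ℕ
    ball w x = 4 * e w x ⊓ r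

    -- The truncated distance from `w` pulls the line back to a pseudometric. Its `closed` is the
    -- total variation of the truncated distance along a tour, and `e≤closed` bounds that variation
    -- from below.
    module Variation (w : ℕ) =
      Tours (λ x y → ∣ ball w x - ball w y ∣) (λ x → ∣n-n∣≡0 (ball w x))
            (λ x y → ∣-∣-comm (ball w x) (ball w y)) (λ x y z → ∣-∣-triangle (ball w x) (ball w y) (ball w z))

    inBall : ℕ → ℕ → ℕ → ℕ
    inBall x c w = decide (4 * e w x <? r) c 0

    ball-step : ∀ w x y → 4 * e w x ≤ 4 * e w y + 4 * e x y
    ball-step w x y = ≤-trans (*-monoʳ-≤ 4 (e-tri w y x))
      (≤-reflexive (trans (*-distribˡ-+ 4 (e w y) (e y x)) (cong (λ d → 4 * e w y + 4 * d) (e-sym y x))))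

    lipschitz : ∀ w x y → ∣ ball w x - ball w y ∣ ≤ 4 * e x y
    lipschitz w x y = ∣-∣-bound (ball w x) (ball w y) (⊓-lipschitz (4 * e w y) _ r (ball-step w x y))
      (⊓-lipschitz (4 * e w x) _ r (≤-trans (ball-step w y x) (≤-reflexive (cong (λ d → 4 * e w x + 4 * d) (e-sym y x)))))

    -- Outside the ball the truncated distance is constantly `r`, so it changes along an edge only
    -- if an end lies inside, and then by at most the scaled length of the edge.
    step-variation : ∀ x y w → ∣ ball w x - ball w y ∣ ≤ inBall x (4 * e x y) w + inBall y (4 * e x y) w
    step-variation x y w with 4 * e w x <? r | 4 * e w y <? r
    ... | yes _ | _     = ≤-trans (lipschitz w x y) (m≤m+n _ _)
    ... | no _  | yes _ = lipschitz w x y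
    ... | no x≮ | no y≮ rewrite m≥n⇒m⊓n≡n (≮⇒≥ x≮) | m≥n⇒m⊓n≡n (≮⇒≥ y≮) = ≤-reflexive (∣n-n∣≡0 r)

    Separated : List ℕ → Set
    Separated = AllPairs (λ w w′ → r ≤ 2 * e w w′)

    -- Balls of radius `r`/4 around centers at mutual distance at least `r`/2 are disjoint, so `x`
    -- is charged to at most one center.
    inBall-unique : ∀ {Z} → Separated Z → ∀ x c → ∑ (inBall x c) Z ≤ c
    inBall-unique []                    x c = z≤n
    inBall-unique {w ∷ Z} (w# ∷ sep) x c with 4 * e w x <? r
    ... | no _   = inBall-unique sep x c
    ... | yes wx = ≤-reflexive (trans (cong (c +_) (trans (∑-cong Z outside) (∑-0 Z))) (+-identityʳ c))
      where
      outside : ∀ {w′} → w′ ∈ Z → inBall x c w′ ≡ 0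
      outside {w′} w′∈ with 4 * e w′ x <? r
      ... | no _    = refl
      ... | yes w′x = ⊥-elim (<-irrefl refl (begin-strict
        r + r                       ≤⟨ +-mono-≤ (All.lookup w# w′∈) (All.lookup w# w′∈) ⟩
        2 * e w w′ + 2 * e w w′     ≡⟨ arith (e w w′) ⟩
        4 * e w w′                  ≤⟨ ball-step w w′ x ⟩
        4 * e w x + 4 * e w′ x      <⟨ +-mono-< wx w′x ⟩
        r + r                       ∎))
        where
        open ≤-Reasoning
        arith : ∀ d → 2 * d + 2 * d ≡ 4 * d
        arith = solve-∀

    variation≤ : ∀ {Z} → Separated Z → ∀ x y → ∑ (λ w → ∣ ball w x - ball w y ∣) Z ≤ 8 * e x y
    variation≤ {Z} sep x y = begin
      ∑ (λ w → ∣ ball w x - ball w y ∣) Z                        ≤⟨ ∑-mono Z (λ {w} _ → step-variation x y w) ⟩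
      ∑ (λ w → inBall x (4 * e x y) w + inBall y (4 * e x y) w) Z ≡⟨ ∑-+ (inBall x _) (inBall y _) Z ⟩
      ∑ (inBall x (4 * e x y)) Z + ∑ (inBall y (4 * e x y)) Z    ≤⟨ +-mono-≤ (inBall-unique sep x _) (inBall-unique sep y _) ⟩
      4 * e x y + 4 * e x y                                      ≡⟨ arith (e x y) ⟩
      8 * e x y                                                  ∎
      where
      open ≤-Reasoning
      arith : ∀ d → 4 * d + 4 * d ≡ 8 * d
      arith = solve-∀

    closed-variation≤ : ∀ {Z} → Separated Z → ∀ C → ∑ (λ w → Variation.closed w C) Z ≤ 8 * closed C
    closed-variation≤ {Z} sep []      = ≤-reflexive (∑-0 Z)
    closed-variation≤ {Z} sep (x ∷ l) = go x l x
      where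
      go : ∀ x l z → ∑ (λ w → Variation.walk w x l z) Z ≤ 8 * walk x l z
      go x []      z = variation≤ sep x z
      go x (y ∷ l) z = ≤-trans (≤-reflexive (∑-+ (λ w → ∣ ball w x - ball w y ∣) _ Z))
        (≤-trans (+-mono-≤ (variation≤ sep x y) (go y l z)) (≤-reflexive (sym (*-distribˡ-+ 8 (e x y) _))))

    -- The tour through a center `w` also visits a point at distance at least `r` from it, so the
    -- truncated distance from `w` climbs from 0 to `r` along the tour. As the balls are disjoint,
    -- the variations over all centers add up to at most 8 times the length of the tours, and
    -- doubling the edges of `G` turns 8 into 16.
    packing : ∀ {V} G → Within (_∈ V) G → ∀ {Z} → Separated Z →
      (∀ {w} → w ∈ Z → w ∈ V × ∃[ p ] p ∈ V × lab G p ≡ lab G w × r ≤ e w p) →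
      length Z * r ≤ 16 * price e G
    packing G G⊆ {Z} sep far with S , T , w ← tour G G⊆ = begin
      length Z * r                                                 ≡⟨ ∑-const r Z ⟨
      ∑ (λ _ → r) Z                                                ≤⟨ ∑-mono Z escape ⟩
      ∑ (λ w → ∑ (λ c → Variation.closed w (proj₁ c)) S) Z         ≡⟨ ∑-swap (λ w c → Variation.closed w (proj₁ c)) Z S ⟩
      ∑ (λ c → ∑ (λ w → Variation.closed w (proj₁ c)) Z) S         ≤⟨ ∑-mono S (λ {c} _ → ≤-trans (closed-variation≤ sep (proj₁ c)) (*-monoʳ-≤ 8 (m≤m+n (closed (proj₁ c)) (proj₂ c)))) ⟩
      ∑ (λ c → 8 * weight c) S                                     ≡⟨ scale S ⟩
      8 * ∑ weight S                                               ≤⟨ *-monoʳ-≤ 8 w ⟩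
      8 * (2 * price e G)                                             ≡⟨ *-assoc 8 2 (price e G) ⟨
      16 * price e G                                                  ∎
      where
      open ≤-Reasoning
      scale : ∀ S → ∑ (λ c → 8 * weight c) S ≡ 8 * ∑ weight S
      scale []      = refl
      scale (c ∷ S) = trans (cong (8 * weight c +_) (scale S)) (sym (*-distribˡ-+ 8 (weight c) _))
      escape : ∀ {w} → w ∈ Z → r ≤ ∑ (λ c → Variation.closed w (proj₁ c)) S
      escape {w} w∈ with w∈V , p , p∈V , p≡w , r≤ ← far w∈ with c , c∈ , cl ← class T w∈V = begin
        r                              ≡⟨ m≥n⇒m⊓n≡n (≤-trans r≤ (m≤m+n _ _)) ⟨
        ball w p                       ≡⟨ ∣-∣-identityˡ (ball w p) ⟨
        ∣ 0 - ball w p ∣               ≡⟨ cong (λ m → ∣ 4 * m ⊓ r - ball w p ∣) (e-refl w) ⟨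
        ∣ ball w w - ball w p ∣        ≤⟨ Variation.e≤closed w (proj₁ (cl w∈V refl)) (proj₁ (cl p∈V p≡w)) ⟩
        Variation.closed w (proj₁ c)   ≤⟨ ∑-∈ (λ c → Variation.closed w (proj₁ c)) c∈ ⟩
        ∑ (λ c → Variation.closed w (proj₁ c)) S ∎

-- The online algorithm

opaque

  terms : ℕ → ℕ → List ℕ
  terms a t = filter (2 * a ≤?_) (downFrom (2 * t))

  ∈-terms⁺ : ∀ {a t x} → 2 * a ≤ x → x < 2 * t → x ∈ terms a t
  ∈-terms⁺ {a} ≤x x< = ∈-filter⁺ (2 * a ≤?_) (∈-downFrom⁺ x<) ≤x

  ∈-terms⁻ : ∀ {a t x} → x ∈ terms a t → 2 * a ≤ x × x < 2 * t
  ∈-terms⁻ {a} {t} x∈ = let x∈′ , ≤x = ∈-filter⁻ (2 * a ≤?_) {xs = downFrom (2 * t)} x∈ in ≤x , ∈-downFrom⁻ x∈′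

pairs : ℕ → List Edge
pairs t = map (λ i → 2 * i , suc (2 * i)) (downFrom t)

Respects : List Edge → List Edge → Set
Respects Q E = All (λ p → lab E (proj₁ p) ≡ lab E (proj₂ p)) Q

respects? : ∀ Q E → Dec (Respects Q E)
respects? Q E = All.all? (λ p → lab E (proj₁ p) ≟ lab E (proj₂ p)) Q

-- Limiting the number of edges by the number of terminals makes the search finite, and the
-- solutions built by `sparsify` respect this limit.
candidates : List ℕ → List Edge → List (List Edge)
candidates T Q = filter (respects? Q) (listsUpTo (length T) (cartesianProduct T T))

AgreeOn : List ℕ → Metric → Metric → Set
AgreeOn T e e′ = ∀ {x y} → x ∈ T → y ∈ T → e x y ≡ e′ x y

cost-cong : ∀ {T e e′ E} → AgreeOn T e e′ → Within (_∈ T) E → price e E ≡ price e′ E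
cost-cong {E = E} agree E⊆ = ∑-cong E λ {(a , b)} e∈ → let a∈ , b∈ = E⊆ e∈ in agree a∈ b∈

respects-self : ∀ Q → Respects Q Q
respects-self Q = All.tabulate (λ {(a , b)} → lab-edge {a} {b})

module _ {T : List ℕ} {Q : List Edge} where

  ∈-candidates⁺ : ∀ {E} → Within (_∈ T) E → length E ≤ length T → Respects Q E → E ∈ candidates T Q
  ∈-candidates⁺ E⊆ le resp = ∈-filter⁺ (respects? Q)
    (∈-listsUpTo⁺ (length T) (All.tabulate λ {(a , b)} e∈ → let a∈ , b∈ = E⊆ e∈ in ∈-cartesianProduct⁺ a∈ b∈) le) resp

  ∈-candidates⁻ : ∀ {E} → E ∈ candidates T Q → Within (_∈ T) E × length E ≤ length T × Respects Q E
  ∈-candidates⁻ E∈ with E∈′ , resp ← ∈-filter⁻ (respects? Q) {xs = listsUpTo (length T) (cartesianProduct T T)} E∈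
    with E⊆ , le ← ∈-listsUpTo⁻ (length T) E∈′
    = (λ e∈ → ∈-cartesianProduct⁻ T T (All.lookup E⊆ e∈)) , le , resp

opaque

  -- The cheapest solution for the demands Q on the terminals T; Q itself is a fallback.
  best : Metric → List ℕ → List Edge → List Edge
  best e T Q = minBy (price e) Q (candidates T Q)

module _ {T : List ℕ} {Q : List Edge} where

  opaque
    unfolding best

    best-respects : ∀ e → Respects Q (best e T Q)
    best-respects e with minBy-∈ (price e) Q (candidates T Q)
    ... | here eq  = subst (Respects Q) (sym eq) (respects-self Q)
    ... | there b∈ = proj₂ (proj₂ (∈-candidates⁻ {T} {Q} b∈))

    best-within : ∀ e → Within (_∈ T) Q → Within (_∈ T) (best e T Q)
    best-within e Q⊆ with minBy-∈ (price e) Q (candidates T Q)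
    ... | here eq  = subst (Within (_∈ T)) (sym eq) Q⊆
    ... | there b∈ = proj₁ (∈-candidates⁻ {T} {Q} b∈)

    best-length : ∀ e → length (best e T Q) ≤ length T + length Q
    best-length e with minBy-∈ (price e) Q (candidates T Q)
    ... | here eq  rewrite eq = m≤n+m _ _
    ... | there b∈ = ≤-trans (proj₁ (proj₂ (∈-candidates⁻ {T} {Q} b∈))) (m≤m+n _ _)

    best-≤ : ∀ e {E} → Within (_∈ T) E → length E ≤ length T → Respects Q E → price e (best e T Q) ≤ price e E
    best-≤ e E⊆ le resp = minBy-≤ (price e) Q (candidates T Q) (there (∈-candidates⁺ {T} {Q} E⊆ le resp))

opaque
  unfolding best

  best-cong : ∀ {T e e′ Q} → AgreeOn T e e′ → Within (_∈ T) Q → best e T Q ≡ best e′ T Q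
  best-cong {T} {Q = Q} agree Q⊆ = minBy-cong Q (candidates T Q) λ where
    (here refl) → cost-cong agree Q⊆
    (there E∈)  → cost-cong agree (proj₁ (∈-candidates⁻ {T} {Q} E∈))

opt : Metric → ℕ → ℕ
opt e t = price e (best e (terms 0 t) (pairs t))

-- don holds the edges of finished phases. For the current phase, start is its first pair, ref the optimum at
-- its beginning, sol its edges, dem its pairs and hooks, cen j its centers of scale j, scl the scales of its
-- arrivals, and acc the cost bought since sol was last recomputed.
record State : Set where
  constructor state
  field
    don       : List Edge
    start ref : ℕ
    sol dem   : List Edge
    cen       : ℕ → List ℕ
    scl       : List ℕ
    acc       : ℕ

open State

output : State → List Edge
output s = don s ++ sol s

-- The terminals u_t and v_t.
left right : ℕ → ℕ
left t  = 2 * t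
right t = suc (2 * t)

near : Metric → ℕ → ℕ → List ℕ → Maybe ℕ
near e r x []      = nothing
near e r x (c ∷ Z) = decide (2 * e x c <? r) (just c) (near e r x Z)

hook : ℕ → Maybe ℕ → List Edge
hook x nothing  = []
hook x (just c) = [ x , c ]

admit : ℕ → Maybe ℕ → List ℕ → List ℕ
admit x nothing  Z = x ∷ Z
admit x (just c) Z = Z

detour : Metric → ℕ → ℕ × ℕ → ℕ
detour e t (w , w′) = e (2 * t) w + e w′ (suc (2 * t))

joined? : ∀ E (p : ℕ × ℕ) → Dec (lab E (proj₁ p) ≡ lab E (proj₂ p))
joined? E p = lab E (proj₁ p) ≟ lab E (proj₂ p)

opaque

  joints : ℕ → State → List (ℕ × ℕ)
  joints t s = filter (joined? (sol s)) (cartesianProduct (terms (start s) t) (terms (start s) t))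

  link : Metric → ℕ → State → ℕ × ℕ
  -- The default pair (v, v) stands for the direct edge: its detour is `e` u v plus `e` v v.
  link e t s = minBy (detour e t) (suc (2 * t) , suc (2 * t)) (joints t s)

fresh : ℕ → ℕ → State → State
fresh t o s = state (output s) t o [] [] (λ _ → []) [] 0

-- The optimum is taken with the arriving pair included, so a pair that makes it more than double
-- already belongs to the new phase and counts in its `ref`.
enter : Metric → ℕ → State → State
enter e t s = decide (opt e (suc t) ≤? 2 * ref s) s (fresh t (opt e (suc t)) s)

extend : ℕ → State → ℕ × ℕ → ℕ → Maybe ℕ → Maybe ℕ → ℕ → State
extend t s (w , w′) j mu mv c = record s
  -- With the default link these are the edge u-v and a loop at v. The loop is free and is never
  -- counted by `edgeAt`, which asks for x < y.
  { sol = (u , w) ∷ (w′ , v) ∷ hook u mu ++ hook v mv ++ sol s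
  ; dem = (u , v) ∷ hook u mu ++ hook v mv ++ dem s
  ; cen = λ i → decide (i ≟ j) (admit u mu (admit v mv (cen s j))) (cen s i)
  ; scl = j ∷ scl s
  ; acc = c + acc s
  }
  where
  u = 2 * t
  v = suc (2 * t)

opaque

  scale : ℕ → ℕ
  scale = ⌊log₂_⌋

attach : Metric → ℕ → State → ℕ × ℕ → ℕ → State
attach e t s p ℓ = extend t s p j mu mv (ℓ + (price e (hook u mu) + price e (hook v mv)))
  where
  u = 2 * t
  v = suc (2 * t)
  j = scale ℓ
  mu = near e (2 ^ j) u (cen s j)
  mv = near e (2 ^ j) v (cen s j)

arrive : Metric → ℕ → State → State
arrive e t s = attach e t s (link e t s) (detour e t (link e t s))

settle : Metric → ℕ → State → State
settle e t s = decide (acc s ≤? ref s) s (record s { sol = best e (terms (start s) t) (dem s) ; acc = 0 })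

advance : Metric → ℕ → State → State
advance e t s = settle e (suc t) (arrive e t (enter e t s))

stateAt : Metric → ℕ → State
stateAt e zero    = state [] 0 0 [] [] (λ _ → []) [] 0
stateAt e (suc t) = advance e t (stateAt e t)

near-∈ : ∀ e r x {c} Z → near e r x Z ≡ just c → c ∈ Z × 2 * e x c < r
near-∈ e r x (c ∷ Z) eq with 2 * e x c <? r
near-∈ e r x (c ∷ Z) refl | yes p = here refl , p
near-∈ e r x (c ∷ Z) eq   | no _  = let c∈ , p = near-∈ e r x Z eq in there c∈ , p

near-∉ : ∀ e r x Z → near e r x Z ≡ nothing → All (λ c → r ≤ 2 * e x c) Z
near-∉ e r x []      eq = []
near-∉ e r x (c ∷ Z) eq with 2 * e x c <? r
... | no ≮ = ≮⇒≥ ≮ ∷ near-∉ e r x Z eq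

near-cong : ∀ {T e e′} r {x} Z → AgreeOn T e e′ → x ∈ T → (∀ {c} → c ∈ Z → c ∈ T) → near e r x Z ≡ near e′ r x Z
near-cong r []      agree x∈ Z⊆ = refl
near-cong {e′ = e′} r {x} (c ∷ Z) agree x∈ Z⊆
  rewrite agree x∈ (Z⊆ (here refl)) = cong (decide (2 * e′ x c <? r) (just c)) (near-cong r Z agree x∈ (Z⊆ ∘ there))

-- Vertices of a state and dependence on the revealed distances

record Range (t : ℕ) (s : State) : Set where
  field
    start≤ : start s ≤ t
    don⊆   : Within (_< 2 * start s) (don s)
    sol⊆   : Within (_∈ terms (start s) t) (sol s)
    dem⊆   : Within (_∈ terms (start s) t) (dem s)
    cen⊆   : ∀ j {c} → c ∈ cen s j → c ∈ terms (start s) t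

open Range

terms-suc : ∀ {a t x} → x ∈ terms a t → x ∈ terms a (suc t)
terms-suc {a} {t} x∈ = let ≤x , x< = ∈-terms⁻ {a} {t} x∈ in ∈-terms⁺ ≤x (<-≤-trans x< (*-monoʳ-≤ 2 (n≤1+n t)))

2i<2t : ∀ {i t} → i < t → 2 * i < 2 * t
2i<2t = *-monoʳ-< 2

1+2i<2t : ∀ {i t} → i < t → suc (2 * i) < 2 * t
1+2i<2t {i} {t} i<t = ≤-trans (≤-reflexive (sym (*-suc 2 i))) (*-monoʳ-≤ 2 i<t)

module _ {a t : ℕ} (a≤t : a ≤ t) where

  new₁∈ : 2 * t ∈ terms a (suc t)
  new₁∈ = ∈-terms⁺ (*-monoʳ-≤ 2 a≤t) (2i<2t ≤-refl)

  new₂∈ : suc (2 * t) ∈ terms a (suc t)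
  new₂∈ = ∈-terms⁺ (m≤n⇒m≤1+n (*-monoʳ-≤ 2 a≤t)) (1+2i<2t ≤-refl)

pairs-within : ∀ t → Within (_∈ terms 0 t) (pairs t)
pairs-within t e∈ with i , i∈ , refl ← ∈-map⁻ _ e∈ =
  let i<t = ∈-downFrom⁻ i∈ in ∈-terms⁺ z≤n (2i<2t i<t) , ∈-terms⁺ z≤n (1+2i<2t i<t)

data Link (t : ℕ) (s : State) : ℕ × ℕ → Set where
  direct : Link t s (suc (2 * t) , suc (2 * t))
  via    : ∀ {w w′} → w ∈ terms (start s) t → w′ ∈ terms (start s) t →
           lab (sol s) w ≡ lab (sol s) w′ → Link t s (w , w′)

opaque
  unfolding link

  ∈-joints⁻ : ∀ {t s p} → p ∈ (suc (2 * t) , suc (2 * t)) ∷ joints t s → Link t s p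
  ∈-joints⁻         (here refl) = direct
  ∈-joints⁻ {t} {s} (there p∈)
    with p∈′ , eq ← ∈-filter⁻ (joined? (sol s)) {xs = cartesianProduct (terms (start s) t) (terms (start s) t)} p∈
    = let w∈ , w′∈ = ∈-cartesianProduct⁻ (terms (start s) t) (terms (start s) t) p∈′ in via w∈ w′∈ eq

  ∈-joints⁺ : ∀ {t s w w′} → w ∈ terms (start s) t → w′ ∈ terms (start s) t →
              lab (sol s) w ≡ lab (sol s) w′ → (w , w′) ∈ joints t s
  ∈-joints⁺ {s = s} w∈ w′∈ eq = ∈-filter⁺ (joined? (sol s)) (∈-cartesianProduct⁺ w∈ w′∈) eq

  link-spec : ∀ e t s → Link t s (link e t s)
  link-spec e t s = ∈-joints⁻ {s = s} (minBy-∈ (detour e t) _ (joints t s))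

opaque
  unfolding link

  link-cong : ∀ {e e′ t s} → (∀ {p} → Link t s p → detour e t p ≡ detour e′ t p) → link e t s ≡ link e′ t s
  link-cong {t = t} {s} detour≡ = minBy-cong _ (joints t s) (detour≡ ∘ ∈-joints⁻ {s = s})

  link-≤ : ∀ e t s {p} → p ∈ (suc (2 * t) , suc (2 * t)) ∷ joints t s → detour e t (link e t s) ≤ detour e t p
  link-≤ e t s p∈ = minBy-≤ (detour e t) _ (joints t s) p∈

link-within : ∀ {t s w w′} → start s ≤ t → Link t s (w , w′) →
              w ∈ terms (start s) (suc t) × w′ ∈ terms (start s) (suc t)
link-within {t} a≤t direct         = new₂∈ a≤t , new₂∈ a≤t
link-within     a≤t (via w∈ w′∈ _) = terms-suc w∈ , terms-suc w′∈

within-∷ : ∀ {P : Pred ℕ 0ℓ} {a b E} → P a → P b → Within P E → Within P ((a , b) ∷ E)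
within-∷ Pa Pb E⊆ (here refl) = Pa , Pb
within-∷ Pa Pb E⊆ (there e∈)  = E⊆ e∈

within-++ : ∀ {P : Pred ℕ 0ℓ} E {E′} → Within P E → Within P E′ → Within P (E ++ E′)
within-++ E E⊆ E′⊆ e∈ with ∈-++⁻ E e∈
... | inj₁ e∈E  = E⊆ e∈E
... | inj₂ e∈E′ = E′⊆ e∈E′

within-map : ∀ {P P′ : Pred ℕ 0ℓ} {E} → (∀ {x} → P x → P′ x) → Within P E → Within P′ E
within-map f E⊆ e∈ = let a∈ , b∈ = E⊆ e∈ in f a∈ , f b∈

hook-within : ∀ {P : Pred ℕ 0ℓ} {x} m → P x → (∀ {c} → m ≡ just c → P c) → Within P (hook x m)
hook-within (just c) Px Pc (here refl) = Px , Pc refl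

admit-⊆ : ∀ {x y Z} m → y ∈ admit x m Z → y ≡ x ⊎ y ∈ Z
admit-⊆ nothing  (here eq)  = inj₁ eq
admit-⊆ nothing  (there y∈) = inj₂ y∈
admit-⊆ (just _) y∈         = inj₂ y∈

output-within : ∀ {t s} → Range t s → Within (_< 2 * t) (output s)
output-within {s = s} R = within-++ (don s) (within-map (λ x< → <-≤-trans x< (*-monoʳ-≤ 2 (start≤ R))) (don⊆ R))
                                            (within-map (λ x∈ → proj₂ (∈-terms⁻ x∈)) (sol⊆ R))

range-fresh : ∀ {t o s} → Range t s → Range t (fresh t o s)
range-fresh {t} {o} {s} R = record
  { start≤ = ≤-refl
  ; don⊆   = output-within R
  ; sol⊆   = λ ()
  ; dem⊆   = λ ()
  ; cen⊆   = λ _ ()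
  }

range-enter : ∀ e {t s} → Range t s → Range t (enter e t s)
range-enter e {t} {s} R with opt e (suc t) ≤? 2 * ref s
... | yes _ = R
... | no _  = range-fresh R

range-extend : ∀ {t s w w′ j mu mv c} → Range t s →
  w ∈ terms (start s) (suc t) × w′ ∈ terms (start s) (suc t) →
  (∀ {c} → mu ≡ just c → c ∈ cen s j) → (∀ {c} → mv ≡ just c → c ∈ cen s j) →
  Range (suc t) (extend t s (w , w′) j mu mv c)
range-extend {t} {s} {w} {w′} {j} {mu} {mv} {c} R (w∈ , w′∈) mu∈ mv∈ = record
  { start≤ = m≤n⇒m≤1+n (start≤ R)
  ; don⊆   = don⊆ R
  ; sol⊆   = within-∷ u∈ w∈ (within-∷ w′∈ v∈ (hooks (within-map terms-suc (sol⊆ R))))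
  ; dem⊆   = within-∷ u∈ v∈ (hooks (within-map terms-suc (dem⊆ R)))
  ; cen⊆   = centers
  }
  where
  T = terms (start s) (suc t)
  u∈ = new₁∈ (start≤ R)
  v∈ = new₂∈ (start≤ R)
  hooks : ∀ {E} → Within (_∈ T) E → Within (_∈ T) (hook (2 * t) mu ++ hook (suc (2 * t)) mv ++ E)
  hooks E⊆ = within-++ (hook (2 * t) mu) (hook-within mu u∈ (terms-suc ∘ cen⊆ R j ∘ mu∈))
    (within-++ (hook (suc (2 * t)) mv) (hook-within mv v∈ (terms-suc ∘ cen⊆ R j ∘ mv∈)) E⊆)
  centers : ∀ i {c′} → c′ ∈ decide (i ≟ j) (admit (2 * t) mu (admit (suc (2 * t)) mv (cen s j))) (cen s i) → c′ ∈ T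
  centers i c∈ with i ≟ j
  ... | no _ = terms-suc (cen⊆ R i c∈)
  ... | yes _ with admit-⊆ mu c∈
  ...   | inj₁ refl = u∈
  ...   | inj₂ c∈′ with admit-⊆ mv c∈′
  ...     | inj₁ refl = v∈
  ...     | inj₂ c∈″  = terms-suc (cen⊆ R j c∈″)

range-attach : ∀ e {t s p ℓ} → Range t s → Link t s p → Range (suc t) (attach e t s p ℓ)
range-attach e {t} {s} {p} {ℓ} R l = range-extend R (link-within {s = s} (start≤ R) l)
  (λ eq → proj₁ (near-∈ e (2 ^ scale ℓ) (2 * t) (cen s (scale ℓ)) eq))
  (λ eq → proj₁ (near-∈ e (2 ^ scale ℓ) (suc (2 * t)) (cen s (scale ℓ)) eq))

range-arrive : ∀ e {t s} → Range t s → Range (suc t) (arrive e t s)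
range-arrive e {t} {s} R = range-attach e {t} {s} {link e t s} {detour e t (link e t s)} R (link-spec e t s)

range-settle : ∀ e {t s} → Range t s → Range t (settle e t s)
range-settle e {t} {s} R with acc s ≤? ref s
... | yes _ = R
... | no _  = record
  { start≤ = start≤ R ; don⊆ = don⊆ R ; dem⊆ = dem⊆ R ; cen⊆ = cen⊆ R
  ; sol⊆ = best-within e (dem⊆ R) }

range-stateAt : ∀ e t → Range t (stateAt e t)
range-stateAt e zero    = record { start≤ = z≤n ; don⊆ = λ () ; sol⊆ = λ () ; dem⊆ = λ () ; cen⊆ = λ _ () }
range-stateAt e (suc t) =
  range-settle e {suc t} {arrive e t (enter e t (stateAt e t))}
    (range-arrive e {t} {enter e t (stateAt e t)} (range-enter e {t} {stateAt e t} (range-stateAt e t)))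

opt-cong : ∀ {e e′} t → AgreeOn (terms 0 t) e e′ → opt e t ≡ opt e′ t
opt-cong {e} {e′} t agree rewrite best-cong agree (pairs-within t) =
  cost-cong agree (best-within e′ (pairs-within t))

module _ {e e′ : Metric} {t : ℕ} (agree : AgreeOn (terms 0 (suc t)) e e′) where
  private
    agree′ : ∀ {a} → AgreeOn (terms a (suc t)) e e′
    agree′ x∈ y∈ = agree (∈-terms⁺ z≤n (proj₂ (∈-terms⁻ x∈))) (∈-terms⁺ z≤n (proj₂ (∈-terms⁻ y∈)))

  enter-cong : ∀ s → enter e t s ≡ enter e′ t s
  enter-cong s = cong (λ o → decide (o ≤? 2 * ref s) s (fresh t o s)) (opt-cong (suc t) agree)

  module _ {s : State} (R : Range t s) where
    private
      T = terms (start s) (suc t)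

      detour-cong : ∀ {p} → Link t s p → detour e t p ≡ detour e′ t p
      detour-cong l = let w∈ , w′∈ = link-within {s = s} (start≤ R) l in
        cong₂ _+_ (agree′ (new₁∈ (start≤ R)) w∈) (agree′ w′∈ (new₂∈ (start≤ R)))

      near-eq : ∀ r j {x} → x ∈ T → near e r x (cen s j) ≡ near e′ r x (cen s j)
      near-eq r j x∈ = near-cong r (cen s j) agree′ x∈ (terms-suc ∘ cen⊆ R j)

      hook-eq : ∀ r j {x} → x ∈ T →
        let m = near e′ r x (cen s j) in price e (hook x m) ≡ price e′ (hook x m)
      hook-eq r j {x} x∈ = cost-cong agree′ (hook-within (near e′ r x (cen s j)) x∈
        λ eq → terms-suc (cen⊆ R j (proj₁ (near-∈ e′ r x (cen s j) eq))))

      extend-cong : ∀ p j {mu mu′ mv mv′ c c′} → mu ≡ mu′ → mv ≡ mv′ → c ≡ c′ →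
                    extend t s p j mu mv c ≡ extend t s p j mu′ mv′ c′
      extend-cong p j refl refl refl = refl

      hooks-cong : ∀ r j {x} → x ∈ T → price e (hook x (near e r x (cen s j))) ≡ price e′ (hook x (near e′ r x (cen s j)))
      hooks-cong r j {x} x∈ = trans (cong (price e ∘ hook x) (near-eq r j x∈)) (hook-eq r j x∈)

      attach-cong : ∀ p ℓ → attach e t s p ℓ ≡ attach e′ t s p ℓ
      attach-cong p ℓ = extend-cong p (scale ℓ)
        (near-eq (2 ^ scale ℓ) (scale ℓ) (new₁∈ (start≤ R)))
        (near-eq (2 ^ scale ℓ) (scale ℓ) (new₂∈ (start≤ R)))
        (cong (ℓ +_) (cong₂ _+_ (hooks-cong (2 ^ scale ℓ) (scale ℓ) (new₁∈ (start≤ R)))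
                                (hooks-cong (2 ^ scale ℓ) (scale ℓ) (new₂∈ (start≤ R)))))

    arrive-cong : arrive e t s ≡ arrive e′ t s
    arrive-cong = begin
      attach e t s p (detour e t p)      ≡⟨ cong (λ p → attach e t s p (detour e t p)) p≡p′ ⟩
      attach e t s p′ (detour e t p′)    ≡⟨ cong (attach e t s p′) (detour-cong (link-spec e′ t s)) ⟩
      attach e t s p′ (detour e′ t p′)   ≡⟨ attach-cong p′ (detour e′ t p′) ⟩
      attach e′ t s p′ (detour e′ t p′)  ∎
      where
      open ≡-Reasoning
      p = link e t s
      p′ = link e′ t s
      p≡p′ : p ≡ p′
      p≡p′ = link-cong detour-cong

  settle-cong : ∀ {s} → Range (suc t) s → settle e (suc t) s ≡ settle e′ (suc t) s
  settle-cong {s} R = cong (λ E → decide (acc s ≤? ref s) s (record s { sol = E ; acc = 0 }))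
    (best-cong agree′ (dem⊆ R))

-- This makes the algorithm online: by `Range`, every comparison made up to time `t` concerns
-- distances between terminals that have arrived, so metrics agreeing on these lead to the same
-- state.
stateAt-cong : ∀ {e e′} t → AgreeOn (terms 0 t) e e′ → stateAt e t ≡ stateAt e′ t
stateAt-cong zero agree = refl
stateAt-cong {e} {e′} (suc t) agree rewrite stateAt-cong t (λ x∈ y∈ → agree (terms-suc x∈) (terms-suc y∈)) =
  trans (settle-cong agree {arrive e t (enter e t s)} (range-arrive e R))
    (cong (settle e′ (suc t)) (trans (arrive-cong agree R) (cong (arrive e′ t) (enter-cong agree s))))
  where
  s = stateAt e′ t
  R = range-enter e {t} {s} (range-stateAt e′ t)

-- Powers of two and terminals

half-≤ : ∀ n → 2 * ⌊ n /2⌋ ≤ n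
half-≤ zero          = z≤n
half-≤ (suc zero)    = z≤n
half-≤ (suc (suc n)) = ≤-trans (≤-reflexive (*-suc 2 ⌊ n /2⌋)) (s≤s (s≤s (half-≤ n)))

half-> : ∀ n → n < 2 * suc ⌊ n /2⌋
half-> zero          = s≤s z≤n
half-> (suc zero)    = s≤s (s≤s z≤n)
half-> (suc (suc n)) = ≤-trans (s≤s (s≤s (half-> n))) (≤-reflexive (sym (*-suc 2 (suc ⌊ n /2⌋))))

log-half : ∀ n → 2 ≤ n → ⌊log₂ n ⌋ ≡ suc ⌊log₂ ⌊ n /2⌋ ⌋
log-half n 2≤n = sym (trans (cong suc (⌊log₂⌊n/2⌋⌋≡⌊log₂n⌋∸1 n)) (m+[n∸m]≡n (⌊log₂⌋-mono-≤ 2≤n)))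

log-spec : ∀ n → 1 ≤ n → 2 ^ ⌊log₂ n ⌋ ≤ n × n < 2 ^ suc ⌊log₂ n ⌋
log-spec = <-rec Spec go
  where
  Spec : ℕ → Set
  Spec n = 1 ≤ n → 2 ^ ⌊log₂ n ⌋ ≤ n × n < 2 ^ suc ⌊log₂ n ⌋
  double : ∀ n → 2 ≤ n → Spec ⌊ n /2⌋ → Spec n
  double (suc zero) (s≤s ()) _
  double n@(suc (suc _)) 2≤n spec _ with lo , hi ← spec (s≤s z≤n) =
    subst (λ p → 2 ^ p ≤ n × n < 2 ^ suc p) (sym (log-half n 2≤n))
      (≤-trans (*-monoʳ-≤ 2 lo) (half-≤ n) , <-≤-trans (half-> n) (*-monoʳ-≤ 2 hi))
  go : ∀ n → (∀ {m} → m < n → Spec m) → Spec n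
  go (suc zero)      rec _ = s≤s z≤n , s≤s (s≤s z≤n)
  go n@(suc (suc k)) rec   = double n (s≤s (s≤s z≤n)) (rec (⌊n/2⌋<n (suc k)))

opaque
  unfolding scale

  scale-spec : ∀ {n} → 1 ≤ n → 2 ^ scale n ≤ n × n < 2 ^ suc (scale n)
  scale-spec {n} = log-spec n

scale-≥ : ∀ {j n} → 1 ≤ n → 2 ^ j ≤ n → j ≤ scale n
scale-≥ {j} {n} 1≤n 2^j≤n with j ≤? scale n
... | yes p = p
... | no ≰  = ⊥-elim (<-irrefl refl (<-≤-trans (proj₂ (scale-spec 1≤n)) (≤-trans (^-monoʳ-≤ 2 (≰⇒> ≰)) 2^j≤n)))

count : ℕ → List ℕ → ℕ
count j = ∑ (λ i → decide (i ≟ j) 1 0)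

trim : ℕ → List ℕ → List ℕ
trim h []       = []
trim h (x ∷ xs) = decide (x ≤? h) (x ∷ trim h xs) (trim h xs)

∈-trim : ∀ h xs {j} → j ∈ trim h xs → j ≤ h
∈-trim h (x ∷ xs) j∈ with x ≤? h
∈-trim h (x ∷ xs) (here refl) | yes x≤h = x≤h
∈-trim h (x ∷ xs) (there j∈)  | yes x≤h = ∈-trim h xs j∈
∈-trim h (x ∷ xs) j∈          | no _    = ∈-trim h xs j∈

length-trim : ∀ h xs → length (trim h xs) ≤ length xs
length-trim h []       = z≤n
length-trim h (x ∷ xs) with x ≤? h
... | yes _ = s≤s (length-trim h xs)
... | no _  = m≤n⇒m≤1+n (length-trim h xs)

trim-split : ∀ h xs → (∀ {j} → j ∈ xs → j ≤ suc h) →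
             ∑ (2 ^_) xs ≤ count (suc h) xs * 2 ^ suc h + ∑ (2 ^_) (trim h xs)
trim-split h []       xs≤ = z≤n
trim-split h (x ∷ xs) xs≤ with x ≤? h | x ≟ suc h
... | yes x≤h | yes refl = ⊥-elim (1+n≰n x≤h)
... | yes x≤h | no _     = ≤-trans (+-monoʳ-≤ (2 ^ x) (trim-split h xs (xs≤ ∘ there)))
                             (≤-reflexive (arith (2 ^ x) (count (suc h) xs * 2 ^ suc h) _))
  where arith : ∀ a b c → a + (b + c) ≡ b + (a + c)
        arith = solve-∀
... | no x≰h | yes refl = ≤-trans (+-monoʳ-≤ (2 ^ suc h) (trim-split h xs (xs≤ ∘ there)))
                             (≤-reflexive (sym (+-assoc (2 ^ suc h) _ _)))
... | no x≰h | no x≢    = ⊥-elim (x≢ (≤-antisym (xs≤ (here refl)) (≰⇒> x≰h)))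

count-trim : ∀ h j xs → count j (trim h xs) ≤ count j xs
count-trim h j []       = z≤n
count-trim h j (x ∷ xs) with x ≤? h
... | yes _ = +-monoʳ-≤ (decide (x ≟ j) 1 0) (count-trim h j xs)
... | no _  = ≤-trans (count-trim h j xs) (m≤n+m _ _)

-- Only the k highest scales are charged through the counts; below them the number of terms is enough.
powers-≤ : ∀ k h M xs → (∀ {j} → j ∈ xs → j ≤ h) → (∀ j → count j xs * 2 ^ j ≤ M) →
           2 ^ k * ∑ (2 ^_) xs ≤ 2 ^ k * (k * M) + length xs * 2 ^ h
powers-≤ zero h M xs xs≤ cnt = ≤-trans (≤-reflexive (+-identityʳ _)) (≤-trans (∑-mono xs (λ j∈ → ^-monoʳ-≤ 2 (xs≤ j∈)))
  (≤-reflexive (∑-const (2 ^ h) xs)))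
powers-≤ (suc k) zero M xs xs≤ cnt = ≤-trans (*-monoʳ-≤ (2 ^ suc k) bound) (m≤m+n _ _)
  where
  zeros : ∀ xs → (∀ {j} → j ∈ xs → j ≤ 0) → ∑ (2 ^_) xs ≤ count 0 xs * 1
  zeros []       xs≤ = z≤n
  zeros (x ∷ xs) xs≤ with n≤0⇒n≡0 (xs≤ (here refl))
  ... | refl = s≤s (zeros xs (xs≤ ∘ there))
  bound : ∑ (2 ^_) xs ≤ suc k * M
  bound = ≤-trans (zeros xs xs≤) (≤-trans (cnt 0) (m≤m+n M (k * M)))
-- The top scale is charged `M` and removed. The induction hypothesis for one scale less is doubled,
-- which turns 2 ^ h into 2 ^ (h + 1) and 2 ^ k into 2 ^ (k + 1).
powers-≤ (suc k) (suc h) M xs xs≤ cnt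
  with rec ← powers-≤ k h M (trim h xs) (∈-trim h xs)
               (λ j → ≤-trans (*-monoˡ-≤ (2 ^ j) (count-trim h j xs)) (cnt j))
     | split ← trim-split h xs xs≤
  = begin
  2 * 2 ^ k * ∑ (2 ^_) xs                                     ≤⟨ *-monoʳ-≤ (2 * 2 ^ k) (≤-trans split (+-monoˡ-≤ _ (cnt (suc h)))) ⟩
  2 * 2 ^ k * (M + ∑ (2 ^_) (trim h xs))                      ≡⟨ arith₁ (2 ^ k) M _ ⟩
  2 * 2 ^ k * M + 2 * (2 ^ k * ∑ (2 ^_) (trim h xs))          ≤⟨ +-monoʳ-≤ (2 * 2 ^ k * M) (*-monoʳ-≤ 2 (≤-trans rec (+-monoʳ-≤ (2 ^ k * (k * M)) (*-monoˡ-≤ (2 ^ h) (length-trim h xs))))) ⟩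
  2 * 2 ^ k * M + 2 * (2 ^ k * (k * M) + length xs * 2 ^ h)   ≡⟨ arith₂ (2 ^ k) M k (length xs) (2 ^ h) ⟩
  2 * 2 ^ k * (suc k * M) + length xs * (2 * 2 ^ h)           ∎
  where
  open ≤-Reasoning
  arith₁ : ∀ p m s → 2 * p * (m + s) ≡ 2 * p * m + 2 * (p * s)
  arith₁ = solve-∀
  arith₂ : ∀ p m k l q → 2 * p * m + 2 * (p * (k * m) + l * q) ≡ 2 * p * (suc k * m) + l * (2 * q)
  arith₂ = solve-∀

length-filter-≥ : ∀ c k → length (filter (c ≤?_) (downFrom k)) ≤ k ∸ c
length-filter-≥ c zero    = z≤n
length-filter-≥ c (suc k) with c ≤? k
... | yes c≤k rewrite filter-accept (c ≤?_) {xs = downFrom k} c≤k =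
  ≤-trans (s≤s (length-filter-≥ c k)) (≤-reflexive (sym (+-∸-assoc 1 c≤k)))
... | no c≰k rewrite filter-reject (c ≤?_) {xs = downFrom k} c≰k =
  ≤-trans (length-filter-≥ c k) (∸-monoˡ-≤ c (n≤1+n k))

length-filter-< : ∀ c k → length (filter (_<? c) (downFrom k)) ≤ c
length-filter-< c zero    = z≤n
length-filter-< c (suc k) with k <? c
... | yes k<c rewrite filter-accept (_<? c) {xs = downFrom k} k<c =
  ≤-trans (s≤s (≤-trans (length-filter (_<? c) (downFrom k)) (≤-reflexive (length-downFrom k)))) k<c
... | no k≮c rewrite filter-reject (_<? c) {xs = downFrom k} k≮c = length-filter-< c k

opaque
  unfolding terms

  terms≡ : ∀ a t → terms a t ≡ filter (2 * a ≤?_) (downFrom (2 * t))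
  terms≡ a t = refl

  length-terms : ∀ a t → length (terms a t) ≤ 2 * (t ∸ a)
  length-terms a t = ≤-trans (length-filter-≥ (2 * a) (2 * t)) (≤-reflexive (sym (*-distribˡ-∸ 2 t a)))

  length-terms₀ : ∀ t → 2 * t ≤ length (terms 0 t)
  length-terms₀ t = ≤-reflexive (sym (trans (all (2 * t)) (length-downFrom (2 * t))))
    where
    all : ∀ k → length (filter (0 ≤?_) (downFrom k)) ≡ length (downFrom k)
    all zero    = refl
    all (suc k) = cong suc (all k)

partner : ℕ → ℕ
partner zero          = 1
partner (suc zero)    = 0
partner (suc (suc x)) = suc (suc (partner x))

partner-even : ∀ i → partner (2 * i) ≡ suc (2 * i)
partner-even zero    = refl
partner-even (suc i) rewrite +-suc i (i + 0) = cong (λ x → suc (suc x)) (partner-even i)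

partner-odd : ∀ i → partner (suc (2 * i)) ≡ 2 * i
partner-odd zero    = refl
partner-odd (suc i) rewrite +-suc i (i + 0) = cong (λ x → suc (suc x)) (partner-odd i)

data Parity (t : ℕ) : ℕ → Set where
  even : ∀ {i} → i < t → Parity t (2 * i)
  odd  : ∀ {i} → i < t → Parity t (suc (2 * i))

parity : ∀ t {x} → x < 2 * t → Parity t x
parity (suc t) {zero}        x< = even {i = 0} (s≤s z≤n)
parity (suc t) {suc zero}    x< = odd {i = 0} (s≤s z≤n)
parity (suc t) {suc (suc x)} x< with parity t {x} (≤-pred (≤-pred (≤-trans x< (≤-reflexive (*-suc 2 t)))))
... | even {i} i<t = subst (Parity (suc t)) (*-suc 2 i) (even (s≤s i<t))
... | odd {i} i<t  = subst (Parity (suc t)) (cong suc (*-suc 2 i)) (odd (s≤s i<t))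

-- Analysis of the algorithm

data Near (e : Metric) (r x : ℕ) (Z : List ℕ) : Maybe ℕ → Set where
  found : ∀ {c} → c ∈ Z → 2 * e x c < r → Near e r x Z (just c)
  none  : All (λ c → r ≤ 2 * e x c) Z → Near e r x Z nothing

near-spec : ∀ e r x Z → Near e r x Z (near e r x Z)
near-spec e r x Z with near e r x Z in eq
... | just c  = let c∈ , lt = near-∈ e r x Z eq in found c∈ lt
... | nothing = none (near-∉ e r x Z eq)

hook-cost : ∀ {e r x Z m} → Near e r x Z m → 2 * price e (hook x m) ≤ r
hook-cost {e} {r} {x} (found {c} _ lt) = ≤-trans (≤-reflexive (cong (2 *_) (+-identityʳ (e x c)))) (<⇒≤ lt)
hook-cost (none _) = z≤n

hook-length : ∀ x m → length (hook x m) ≤ 1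
hook-length x nothing  = z≤n
hook-length x (just _) = ≤-refl

Serves : ℕ → List Edge → Set
Serves t E = ∀ {i} → i < t → lab E (2 * i) ≡ lab E (suc (2 * i))

respects-pairs⁻ : ∀ t E → Respects (pairs t) E → Serves t E
respects-pairs⁻ t E resp i<t = All.lookup resp (∈-map⁺ _ (∈-downFrom⁺ i<t))

respects-pairs⁺ : ∀ t E → Serves t E → Respects (pairs t) E
respects-pairs⁺ t E serves = All.tabulate λ p∈ → let i , i∈ , eq = ∈-map⁻ _ p∈ in
  subst (λ p → lab E (proj₁ p) ≡ lab E (proj₂ p)) (sym eq) (serves (∈-downFrom⁻ i∈))

-- Lists are compared as sets: `A` covers the insertions and `R` the deletions, so an edge that
-- occurs repeatedly, or is removed and bought again, causes no change.
Edit : ℕ → List Edge → List Edge → Set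
Edit k l l′ = ∃[ A ] ∃[ R ] (∀ {p} → p ∈ l′ → p ∈ A ++ l) × (∀ {p} → p ∈ l → p ∈ R ++ l′) × length A + length R ≤ k

edit-insert : ∀ D N S {k} → length N ≤ k → Edit k (D ++ S) (D ++ N ++ S)
edit-insert D N S N≤ = N , [] , toNew , toOld , ≤-trans (≤-reflexive (+-identityʳ _)) N≤
  where
  toNew : ∀ {p} → p ∈ D ++ N ++ S → p ∈ N ++ D ++ S
  toNew p∈ with ∈-++⁻ D p∈
  ... | inj₁ p∈D = ∈-++⁺ʳ N (∈-++⁺ˡ p∈D)
  ... | inj₂ p∈′ with ∈-++⁻ N p∈′
  ...   | inj₁ p∈N = ∈-++⁺ˡ p∈N
  ...   | inj₂ p∈S = ∈-++⁺ʳ N (∈-++⁺ʳ D p∈S)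
  toOld : ∀ {p} → p ∈ D ++ S → p ∈ D ++ N ++ S
  toOld p∈ with ∈-++⁻ D p∈
  ... | inj₁ p∈D = ∈-++⁺ˡ p∈D
  ... | inj₂ p∈S = ∈-++⁺ʳ D (∈-++⁺ʳ N p∈S)

edit-replace : ∀ D S S′ {k} → length S′ + length S ≤ k → Edit k (D ++ S) (D ++ S′)
edit-replace D S S′ le = S′ , S , moved S′ S , moved S S′ , le
  where
  moved : ∀ S S′ {p} → p ∈ D ++ S → p ∈ S ++ D ++ S′
  moved S S′ p∈ with ∈-++⁻ D p∈
  ... | inj₁ p∈D = ∈-++⁺ʳ S (∈-++⁺ˡ p∈D)
  ... | inj₂ p∈S = ∈-++⁺ˡ p∈S

data Edits (e : Metric) : ℕ → ℕ → Set where
  zero : Edits e 0 0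
  suc  : ∀ {t b k} → Edits e t b → Edit k (output (stateAt e t)) (output (stateAt e (suc t))) → Edits e (suc t) (b + k)

module Analysis (e : Metric)
                (e-refl : ∀ x → e x x ≡ 0)
                (e-sym : ∀ x y → e x y ≡ e y x)
                (e-tri : ∀ x y z → e x z ≤ e x y + e y z)
                (n : ℕ)
                (e-pos : ∀ {x y} → x < 2 * n → y < 2 * n → x ≢ y → 1 ≤ e x y) where

  open Forests e e-refl e-sym e-tri

  width : ℕ → ℕ
  width x = e x (partner x)

  -- The condition under which `join` lets the freed budget pay for the edge.
  Short : ℕ → ℕ → Set
  Short x y = 2 * e x y ≤ width x × 2 * e x y ≤ width y

  width-even : ∀ i → width (2 * i) ≡ e (2 * i) (suc (2 * i))
  width-even i = cong (e (2 * i)) (partner-even i)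

  width-odd : ∀ i → width (suc (2 * i)) ≡ e (2 * i) (suc (2 * i))
  width-odd i = trans (cong (e (suc (2 * i))) (partner-odd i)) (e-sym _ _)

  partnered : ∀ t G → Serves t G → ∀ {y} → y ∈ downFrom (2 * t) →
              ∃[ p ] p ∈ downFrom (2 * t) × lab G p ≡ lab G y × width y ≤ e y p
  partnered t G serves y∈ with parity t (∈-downFrom⁻ y∈)
  ... | even {i} i<t = suc (2 * i) , ∈-downFrom⁺ (1+2i<2t i<t) , sym (serves i<t) , ≤-reflexive (width-even i)
  ... | odd {i} i<t  = 2 * i , ∈-downFrom⁺ (2i<2t i<t) , serves i<t ,
                       ≤-reflexive (cong (e (suc (2 * i))) (partner-odd i))

  Solves : ℕ → List Edge → Set
  Solves t G = Within (_∈ downFrom (2 * t)) G × Serves t G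

  -- A demand is either already connected by `G` or short, so `sparsify` adds all of `Q` at no extra
  -- cost and then restricts to the terminals of the phase. What it returns is one of the candidates
  -- that `best` minimizes over.
  best-approx : ∀ {a t G} → Solves t G → ∀ {Q} → Within (_∈ terms a t) Q →
                (∀ {x y} → (x , y) ∈ Q → lab G x ≡ lab G y ⊎ Short x y) →
                price e (best e (terms a t) Q) ≤ 4 * price e G
  best-approx {a} {t} {G} (G⊆ , serves) {Q} Q⊆ short
    with E , E⊆ , len , cheap , keeps ←
      sparsify width G G⊆ (partnered t G serves) Q (within-map (∈-downFrom⁺ ∘ proj₂ ∘ ∈-terms⁻) Q⊆) short (2 * a ≤?_)
    rewrite sym (terms≡ a t)
    = ≤-trans (best-≤ e E⊆ len (All.tabulate λ {(x , y)} xy∈ →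
        let x∈ , y∈ = Q⊆ xy∈
            a≤x , x<t = ∈-terms⁻ x∈
            a≤y , y<t = ∈-terms⁻ y∈
        in keeps (∈-downFrom⁺ x<t) (∈-downFrom⁺ y<t) a≤x a≤y (lab-edge (∈-++⁺ˡ xy∈)))) cheap

  -- The optimum need not be monotone in time, since later terminals can act as Steiner points for
  -- earlier pairs. Shortcutting a later solution to the first `s` pairs loses at most a factor 4.
  opt-approx : ∀ {s t G} → s ≤ t → Solves t G → opt e s ≤ 4 * price e G
  opt-approx {s} {t} {G} s≤t (G⊆ , serves)
    with E , E⊆ , len , cheap , keeps ←
      sparsify width G G⊆ (partnered t G serves) [] (λ ()) (λ ()) (_<? 2 * s)
    = ≤-trans (best-≤ e
        (within-map (λ x∈ → ∈-terms⁺ z≤n (proj₂ (∈-filter⁻ (_<? 2 * s) {xs = downFrom (2 * t)} x∈))) E⊆)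
        (≤-trans len (≤-trans (length-filter-< (2 * s) (2 * t)) (length-terms₀ s)))
        (respects-pairs⁺ s E λ i<s → let i<t = <-≤-trans i<s s≤t in
          keeps (∈-downFrom⁺ (2i<2t i<t)) (∈-downFrom⁺ (1+2i<2t i<t)) (2i<2t i<s) (1+2i<2t i<s) (serves i<t)))
        cheap

  optimal : ℕ → List Edge
  optimal t = best e (terms 0 t) (pairs t)

  optimal-solves : ∀ t → Solves t (optimal t)
  optimal-solves t =
    within-map (∈-downFrom⁺ ∘ proj₂ ∘ ∈-terms⁻) (best-within {terms 0 t} e (pairs-within t)) ,
    respects-pairs⁻ t (optimal t) (best-respects {terms 0 t} {pairs t} e)

  opt-zero : opt e 0 ≡ 0
  opt-zero = n≤0⇒n≡0 (best-≤ e {[]} (λ ()) z≤n [])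

  width≤opt : ∀ {i t} → i < t → e (2 * i) (suc (2 * i)) ≤ 2 * opt e t
  width≤opt {i} {t} i<t = let G⊆ , serves = optimal-solves t in
    connected⇒close (optimal t) G⊆ (∈-downFrom⁺ (2i<2t i<t)) (∈-downFrom⁺ (1+2i<2t i<t)) (serves i<t)

  -- A represents every dem-component with a center of scale j. It loses an element when an arrival merges two
  -- of them, which bounds the arrivals that create no center.
  Represented : ℕ → State → Set
  Represented j s = ∃[ A ] (∀ {c} → c ∈ cen s j → ∃[ α ] α ∈ A × lab (dem s) α ≡ lab (dem s) c)
                           × count j (scl s) + length A ≤ 2 * length (cen s j)

  -- In `cost-sol`, 8 `ref` accounts for the last recomputed solution (4 times an optimum below 2
  -- `ref`) and `acc` for what was bought since. `dem-short` separates the pairs, which any solution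
  -- connects, from the hooks, which are paid for by budgets.
  record Phase (t : ℕ) (s : State) : Set where
    field
      range       : Range t s
      don-serves  : Serves (start s) (don s)
      sol-dem     : Respects (dem s) (sol s)
      dem-serves  : ∀ {i} → start s ≤ i → i < t → lab (dem s) (2 * i) ≡ lab (dem s) (suc (2 * i))
      dem-short   : ∀ {x y} → (x , y) ∈ dem s → (∃[ i ] i < t × (x , y) ≡ (2 * i , suc (2 * i))) ⊎ Short x y
      cost-don    : price e (don s) ≤ 9 * ref s
      cost-sol    : price e (sol s) ≤ 8 * ref s + acc s
      scl-length  : start s + length (scl s) ≡ t
      scl-bound   : ∀ {j} → j ∈ scl s → 2 ^ j ≤ 4 * ref s
      separated   : ∀ j → Packing.Separated (2 ^ j) (cen s j)
      far         : ∀ j {c} → c ∈ cen s j → 2 ^ j ≤ width c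
      represented : ∀ j → Represented j s
      length-sol  : length (sol s) ≤ 9 * length (scl s)
      length-dem  : length (dem s) ≤ 3 * length (scl s)

  open Phase

  phase-init : Phase 0 (stateAt e 0)
  phase-init = record
    { range = range-stateAt e 0 ; don-serves = λ () ; sol-dem = [] ; dem-serves = λ _ () ; dem-short = λ ()
    ; cost-don = z≤n ; cost-sol = z≤n ; scl-length = refl ; scl-bound = λ ()
    ; separated = λ _ → [] ; far = λ _ () ; represented = λ _ → [] , (λ ()) , z≤n ; length-sol = z≤n ; length-dem = z≤n }

  sol-serves : ∀ {t s} → Phase t s → ∀ {i} → start s ≤ i → i < t → lab (sol s) (2 * i) ≡ lab (sol s) (suc (2 * i))
  sol-serves {s = s} P start≤i i<t = lab-least (sameLabel (sol s)) {dem s} (All.lookup (sol-dem P)) (dem-serves P start≤i i<t)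

  output-serves : ∀ {t s} → Phase t s → Serves t (output s)
  output-serves {s = s} P {i} i<t with i <? start s
  ... | yes i<a = lab-⊆ {don s} ∈-++⁺ˡ (don-serves P i<a)
  ... | no i≮a  = lab-⊆ {sol s} (∈-++⁺ʳ (don s)) (sol-serves P (≮⇒≥ i≮a) i<t)

  cost-output : ∀ {t s} → Phase t s → acc s ≤ ref s → price e (output s) ≤ 18 * ref s
  cost-output {s = s} P small = ≤-trans (≤-reflexive (∑-++ (len e) (don s)))
    (linear 0 (+-mono-≤ (+-mono-≤ (cost-don P) (cost-sol P)) small) (arith (price e (don s)) (price e (sol s)) (ref s) (acc s)))
    where
    arith : ∀ d c r a → d + c + (9 * r + (8 * r + a) + r) + 0 ≡ 18 * r + (d + c + a)
    arith = solve-∀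

  phase-fresh : ∀ {t s} → Phase t s → acc s ≤ ref s → 2 * ref s < opt e (suc t) →
                Phase t (fresh t (opt e (suc t)) s)
  phase-fresh {t} {s} P small grown = record
    { range       = range-fresh (range P)
    ; don-serves  = output-serves P
    ; sol-dem     = []
    ; dem-serves  = λ t≤i i<t → ⊥-elim (<⇒≱ i<t t≤i)
    ; dem-short   = λ ()
    -- The geometric series: the output costs at most 18 times the old `ref`, and the new one is
    -- more than twice as large.
    ; cost-don    = ≤-trans (cost-output P small)
                      (≤-trans (≤-reflexive (*-assoc 9 2 (ref s))) (*-monoʳ-≤ 9 (<⇒≤ grown)))
    ; cost-sol    = z≤n
    ; scl-length  = +-identityʳ t
    ; scl-bound   = λ ()
    ; separated   = λ _ → []
    ; far         = λ _ ()
    ; represented = λ _ → [] , (λ ()) , z≤n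
    ; length-sol  = z≤n
    ; length-dem  = z≤n
    }

  record Arrived (t : ℕ) (s s′ : State) : Set where
    field
      phase′ : Phase (suc t) s′
      ref≡   : ref s′ ≡ ref s
      start≡ : start s′ ≡ start s
      don≡   : don s′ ≡ don s
      grown  : ∃[ j ] scl s′ ≡ j ∷ scl s × acc s′ ≤ 3 * 2 ^ j + acc s
      edit   : Edit 4 (output s) (output s′)

  -- Link, scale and near centers enter only through the inequalities they satisfy. In particular
  -- `ℓ-least` says that no detour through connected terminals of the phase is cheaper.
  module Arrival {t : ℕ} {s : State} {w w′ ℓ j : ℕ} {mu mv : Maybe ℕ} (P : Phase t s)
    (linked : Link t s (w , w′))
    (ℓ≡ : ℓ ≡ e (left t) w + e w′ (right t))
    (ℓ-least : ∀ {c c′} → c ∈ terms (start s) t → c′ ∈ terms (start s) t →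
               lab (sol s) c ≡ lab (sol s) c′ → ℓ ≤ e (left t) c + e c′ (right t))
    (ℓ≤uv : ℓ ≤ e (left t) (right t))
    (ℓ-scale : 2 ^ j ≤ ℓ × ℓ < 2 ^ suc j)
    (bounded : opt e (suc t) ≤ 2 * ref s)
    (nu : Near e (2 ^ j) (left t) (cen s j) mu)
    (nv : Near e (2 ^ j) (right t) (cen s j) mv)
    where

    private
      added : ℕ
      added = ℓ + (price e (hook (left t) mu) + price e (hook (right t) mv))

      s′ : State
      s′ = extend t s (w , w′) j mu mv added

      D′ = dem s′
      S′ = sol s′

      hooks = hook (left t) mu ++ hook (right t) mv

      sol⊆sol′ : ∀ {p} → p ∈ sol s → p ∈ S′
      sol⊆sol′ = there ∘ there ∘ ∈-++⁺ʳ (hook (left t) mu) ∘ ∈-++⁺ʳ (hook (right t) mv)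

      dem⊆dem′ : ∀ {p} → p ∈ dem s → p ∈ D′
      dem⊆dem′ = there ∘ ∈-++⁺ʳ (hook (left t) mu) ∘ ∈-++⁺ʳ (hook (right t) mv)

      keepS : ∀ {x y} → lab (sol s) x ≡ lab (sol s) y → lab S′ x ≡ lab S′ y
      keepS = lab-⊆ {sol s} {S′} sol⊆sol′

      keepD : ∀ {x y} → lab (dem s) x ≡ lab (dem s) y → lab D′ x ≡ lab D′ y
      keepD = lab-⊆ {dem s} {D′} dem⊆dem′

      u~v : lab D′ (left t) ≡ lab D′ (right t)
      u~v = lab-edge {left t} {right t} {D′} (here refl)

      r≤uv : 2 ^ j ≤ e (left t) (right t)
      r≤uv = ≤-trans (proj₁ ℓ-scale) ℓ≤uv

      r≤2uv : 2 ^ j ≤ 2 * e (left t) (right t)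
      r≤2uv = ≤-trans r≤uv (m≤m+n _ _)

      r≤u : 2 ^ j ≤ width (left t)
      r≤u = ≤-trans r≤uv (≤-reflexive (sym (width-even t)))

      r≤v : 2 ^ j ≤ width (right t)
      r≤v = ≤-trans r≤uv (≤-reflexive (sym (width-odd t)))

      -- A hook is shorter than half of 2 ^ `j`, whereas the arriving pair and, by `far`, the pair
      -- of the center are at least 2 ^ `j` wide.
      hook-short : ∀ {x m a b} → 2 ^ j ≤ width x → Near e (2 ^ j) x (cen s j) m → (a , b) ∈ hook x m → Short a b
      hook-short r≤x (found c∈ lt) (here refl) = ≤-trans (<⇒≤ lt) r≤x , ≤-trans (<⇒≤ lt) (far P j c∈)

      hook-edge : ∀ {E x m c} → (∀ {p} → p ∈ hook x m → p ∈ E) → m ≡ just c → lab E x ≡ lab E c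
      hook-edge {E} {x} {c = c} ⊆E refl = lab-edge {x} {c} {E} (⊆E (here refl))

      u-hook : ∀ {p} → p ∈ hook (left t) mu → p ∈ D′
      u-hook = there ∘ ∈-++⁺ˡ

      v-hook : ∀ {p} → p ∈ hook (right t) mv → p ∈ D′
      v-hook = there ∘ ∈-++⁺ʳ (hook (left t) mu) ∘ ∈-++⁺ˡ

    -- The detour costs less than twice 2 ^ `j`, and each of the two hooks at most half of 2 ^ `j`.
    cost-added : added ≤ 3 * 2 ^ j
    cost-added = *-cancelˡ-≤ 2 (linear 0
      (+-mono-≤ (<⇒≤ (proj₂ ℓ-scale)) (+-mono-≤ (<⇒≤ (proj₂ ℓ-scale)) (+-mono-≤ (hook-cost nu) (hook-cost nv))))
      (arith ℓ (price e (hook (left t) mu)) (price e (hook (right t) mv)) (2 ^ j)))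
      where
      arith : ∀ l a b r → 2 * (l + (a + b)) + (2 * r + (2 * r + (r + r))) + 0 ≡ 2 * (3 * r) + (l + (l + (2 * a + 2 * b)))
      arith = solve-∀

    added-length : length S′ ≤ 4 + length (sol s)
    added-length = s≤s (s≤s (≤-trans (≤-reflexive (trans (length-++ (hook (left t) mu)) (cong (length (hook (left t) mu) +_) (length-++ (hook (right t) mv)))))
      (≤-trans (+-mono-≤ (hook-length (left t) mu) (+-monoˡ-≤ _ (hook-length (right t) mv))) ≤-refl)))

    phase : Phase (suc t) s′
    phase = record
      { range       = range-extend (range P) (link-within {s = s} (start≤ (range P)) linked) (near∈ nu) (near∈ nv)
      ; don-serves  = don-serves P
      ; sol-dem     = connected ∷ All.++⁺ (All.tabulate (lab-edge ∘ uS)) (All.++⁺ (All.tabulate (lab-edge ∘ vS)) (All.map keepS (sol-dem P)))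
      ; dem-serves  = serves
      ; dem-short   = short
      ; cost-don    = cost-don P
      ; cost-sol    = costs
      ; scl-length  = trans (+-suc (start s) _) (cong suc (scl-length P))
      -- The chain is 2 ^ `j` ≤ `ℓ` ≤ `e` u v ≤ 2 opt ≤ 4 `ref`.
      ; scl-bound   = λ { (here refl) → ≤-trans r≤uv (≤-trans (width≤opt {t} {suc t} ≤-refl) (≤-trans (*-monoʳ-≤ 2 bounded) (≤-reflexive (sym (*-assoc 2 2 (ref s))))))
                        ; (there j∈) → scl-bound P j∈ }
      ; separated   = sep
      ; far         = fars
      ; represented = reps
      ; length-sol  = ≤-trans added-length (≤-trans (+-mono-≤ {4} {9} (s≤s (s≤s (s≤s (s≤s z≤n)))) (length-sol P)) (≤-reflexive (sym (*-suc 9 _))))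
      ; length-dem  = lengths
      }
      where
      uS : ∀ {p} → p ∈ hook (left t) mu → p ∈ S′
      uS = there ∘ there ∘ ∈-++⁺ˡ
      vS : ∀ {p} → p ∈ hook (right t) mv → p ∈ S′
      vS = there ∘ there ∘ ∈-++⁺ʳ (hook (left t) mu) ∘ ∈-++⁺ˡ
      near∈ : ∀ {x m} → Near e (2 ^ j) x (cen s j) m → ∀ {c} → m ≡ just c → c ∈ cen s j
      near∈ (found c∈ _) refl = c∈
      joined : ∀ {w w′} → Link t s (w , w′) → lab S′ w ≡ lab S′ w′
      joined direct       = refl
      joined (via _ _ eq) = keepS eq
      connected : lab S′ (left t) ≡ lab S′ (right t)
      connected = trans (lab-edge {left t} {w} {S′} (here refl)) (trans (joined linked) (lab-edge {w′} {right t} {S′} (there (here refl))))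
      serves : ∀ {i} → start s ≤ i → i < suc t → lab D′ (2 * i) ≡ lab D′ (suc (2 * i))
      serves {i} a≤i i<t+1 with m≤n⇒m<n∨m≡n (≤-pred i<t+1)
      ... | inj₁ i<t  = keepD (dem-serves P a≤i i<t)
      ... | inj₂ refl = u~v
      short : ∀ {x y} → (x , y) ∈ D′ → (∃[ i ] i < suc t × (x , y) ≡ (2 * i , suc (2 * i))) ⊎ Short x y
      short (here refl) = inj₁ (t , ≤-refl , refl)
      short (there p∈) with ∈-++⁻ (hook (left t) mu) p∈
      ... | inj₁ p∈u = inj₂ (hook-short r≤u nu p∈u)
      ... | inj₂ p∈′ with ∈-++⁻ (hook (right t) mv) p∈′
      ...   | inj₁ p∈v = inj₂ (hook-short r≤v nv p∈v)
      ...   | inj₂ p∈D with dem-short P p∈D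
      ...     | inj₁ (i , i<t , eq) = inj₁ (i , m≤n⇒m≤1+n i<t , eq)
      ...     | inj₂ sh             = inj₂ sh
      costs : price e S′ ≤ 8 * ref s + (added + acc s)
      costs = ≤-trans (≤-reflexive total) (linear 0 (cost-sol P)
          (arith ℓ (price e (hook (left t) mu)) (price e (hook (right t) mv)) (price e (sol s)) (ref s) (acc s)))
        where
        total : price e S′ ≡ ℓ + (price e (hook (left t) mu) + (price e (hook (right t) mv) + price e (sol s)))
        total = trans (sym (+-assoc (e (left t) w) _ _)) (cong₂ _+_ (sym ℓ≡)
          (trans (∑-++ (len e) (hook (left t) mu)) (cong (price e (hook (left t) mu) +_) (∑-++ (len e) (hook (right t) mv)))))
        arith : ∀ l c d f r q → l + (c + (d + f)) + (8 * r + q) + 0 ≡ 8 * r + (l + (c + d) + q) + f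
        arith = solve-∀
      lengths : length D′ ≤ 3 * suc (length (scl s))
      lengths = ≤-trans (s≤s (≤-trans (≤-reflexive (trans (length-++ (hook (left t) mu)) (cong (length (hook (left t) mu) +_) (length-++ (hook (right t) mv)))))
        (+-mono-≤ (hook-length (left t) mu) (+-mono-≤ (hook-length (right t) mv) (length-dem P))))) (≤-reflexive (sym (*-suc 3 _)))
      Z = cen s j
      sepV : ∀ {m} → Near e (2 ^ j) (right t) Z m → Packing.Separated (2 ^ j) (admit (right t) m Z)
      sepV (found _ _) = separated P j
      sepV (none v#)   = v# ∷ separated P j
      sepUV : ∀ {m m′} → Near e (2 ^ j) (left t) Z m → Near e (2 ^ j) (right t) Z m′ → Packing.Separated (2 ^ j) (admit (left t) m (admit (right t) m′ Z))
      sepUV (found _ _) nv′           = sepV nv′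
      sepUV (none u#) nv′@(found _ _) = u# ∷ sepV nv′
      -- When both ends become centers, they are separated from each other because their own
      -- distance is at least 2 ^ `j`.
      sepUV (none u#) nv′@(none _)    = (r≤2uv ∷ u#) ∷ sepV nv′
      sep : ∀ i → Packing.Separated (2 ^ i) (cen s′ i)
      sep i with i ≟ j
      ... | yes refl = sepUV nu nv
      ... | no _     = separated P i
      fars : ∀ i {c} → c ∈ cen s′ i → 2 ^ i ≤ width c
      fars i c∈ with i ≟ j
      ... | no _     = far P i c∈
      ... | yes refl with admit-⊆ mu c∈
      ...   | inj₁ refl = r≤u
      ...   | inj₂ c∈′ with admit-⊆ mv c∈′
      ...     | inj₁ refl = r≤v
      ...     | inj₂ c∈″  = far P j c∈″
      Covers : List ℕ → List ℕ → Set
      Covers A Z = ∀ {c} → c ∈ Z → ∃[ α ] α ∈ A × lab D′ α ≡ lab D′ c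
      A = proj₁ (represented P j)
      old : Covers A Z
      old c∈ = let α , α∈ , eq = proj₁ (proj₂ (represented P j)) c∈ in α , α∈ , keepD eq
      counted : count j (scl s) + length A ≤ 2 * length Z
      counted = proj₂ (proj₂ (represented P j))
      covers-∷ : ∀ {A Z x} → Covers A Z → (∃[ α ] α ∈ A × lab D′ α ≡ lab D′ x) → Covers A (x ∷ Z)
      covers-∷ cov covx (here refl) = covx
      covers-∷ cov covx (there c∈)  = cov c∈
      covers-new : ∀ {A Z x} → Covers A Z → Covers (x ∷ A) (x ∷ Z)
      covers-new cov (here refl) = _ , here refl , refl
      covers-new cov (there c∈)  = let α , α∈ , eq = cov c∈ in α , there α∈ , eq
      -- Two centers near both ends of the arrival lie in different components, as the detour through
      -- them would be too short; the arrival merges these components.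
      merged : ∀ {c c′} → c ∈ Z → 2 * e (left t) c < 2 ^ j → c′ ∈ Z → 2 * e (right t) c′ < 2 ^ j → ¬ lab (dem s) c ≡ lab (dem s) c′
      merged {c} {c′} c∈ uc c′∈ vc′ eq = <-irrefl refl (begin-strict
        2 ^ j + 2 ^ j                  ≤⟨ +-mono-≤ (proj₁ ℓ-scale) (proj₁ ℓ-scale) ⟩
        ℓ + ℓ                          ≤⟨ +-mono-≤ short-cut short-cut ⟩
        (e (left t) c + e c′ (right t)) + (e (left t) c + e c′ (right t)) ≡⟨ arith (e (left t) c) (e c′ (right t)) ⟩
        2 * e (left t) c + 2 * e c′ (right t)         ≡⟨ cong (λ d → 2 * e (left t) c + 2 * d) (e-sym c′ (right t)) ⟩
        2 * e (left t) c + 2 * e (right t) c′         <⟨ +-mono-< uc vc′ ⟩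
        2 ^ j + 2 ^ j                  ∎)
        where
        open ≤-Reasoning
        short-cut = ℓ-least (cen⊆ (range P) j c∈) (cen⊆ (range P) j c′∈)
                      (lab-least (sameLabel (sol s)) {dem s} (All.lookup (sol-dem P)) eq)
        arith : ∀ a b → (a + b) + (a + b) ≡ 2 * a + 2 * b
        arith = solve-∀
      repj : ∀ {m m′} → Near e (2 ^ j) (left t) Z m → Near e (2 ^ j) (right t) Z m′ →
             (∀ {p} → p ∈ hook (left t) m → p ∈ D′) → (∀ {p} → p ∈ hook (right t) m′ → p ∈ D′) →
             ∃[ A′ ] Covers A′ (admit (left t) m (admit (right t) m′ Z)) ×
                     suc (count j (scl s)) + length A′ ≤ 2 * length (admit (left t) m (admit (right t) m′ Z))
      repj (none _) (none _) _ _ = (left t) ∷ (right t) ∷ A , covers-new (covers-new old) ,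
        linear 1 counted (arith (count j (scl s)) (length A) (length Z))
        where arith : ∀ c a z → suc c + suc (suc a) + 2 * z + 1 ≡ 2 * suc (suc z) + (c + a)
              arith = solve-∀
      repj (none _) (found c∈ _) _ hv = A , covers-∷ old covu , linear 1 counted (arith (count j (scl s)) (length A) (length Z))
        where arith : ∀ c a z → suc c + a + 2 * z + 1 ≡ 2 * suc z + (c + a)
              arith = solve-∀
              covu = let α , α∈ , eq = old c∈ in α , α∈ , trans eq (trans (sym (hook-edge {D′} hv refl)) (sym u~v))
      repj (found c∈ _) (none _) hu _ = A , covers-∷ old covv , linear 1 counted (arith (count j (scl s)) (length A) (length Z))
        where arith : ∀ c a z → suc c + a + 2 * z + 1 ≡ 2 * suc z + (c + a)
              arith = solve-∀
              covv = let α , α∈ , eq = old c∈ in α , α∈ , trans eq (trans (sym (hook-edge {D′} hu refl)) u~v)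
      repj (found {c} c∈ uc) (found {c′} c′∈ vc′) hu hv
        with α , α∈ , α≡c ← proj₁ (proj₂ (represented P j)) c∈
           | β , β∈ , β≡c′ ← proj₁ (proj₂ (represented P j)) c′∈
        with A′ , A↭ ← ∈⇒↭ β∈
        with ∈-resp-↭ A↭ α∈
      ... | here refl  = ⊥-elim (merged c∈ uc c′∈ vc′ (trans (sym α≡c) β≡c′))
      ... | there α∈A′ = A′ , cover , subst (_≤ 2 * length Z)
              (trans (cong (count j (scl s) +_) (↭-length A↭)) (+-suc (count j (scl s)) (length A′))) counted
        where
        cover : Covers A′ Z
        cover x∈ with old x∈
        ... | γ , γ∈ , γ≡x with ∈-resp-↭ A↭ γ∈
        ...   | there γ∈A′ = γ , γ∈A′ , γ≡x
        -- Whatever the dropped `β` represented is now connected to `α` through the hooks and the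
        -- arriving pair.
        ...   | here refl  = α , α∈A′ , trans (keepD α≡c) (trans (sym (hook-edge {D′} hu refl)) (trans u~v
                (trans (hook-edge {D′} hv refl) (trans (sym (keepD β≡c′)) γ≡x))))
      reps : ∀ i → Represented i s′
      -- Both orders are needed: the centers are updated by testing `i ≟ j`, whereas `count` tests
      -- `j ≟ i`.
      reps i with i ≟ j | j ≟ i
      ... | yes refl | yes _   = repj nu nv u-hook v-hook
      ... | yes refl | no j≢j  = ⊥-elim (j≢j refl)
      ... | no i≢j   | yes j≡i = ⊥-elim (i≢j (sym j≡i))
      ... | no _     | no _    = let A , cov , cnt = represented P i in
        A , (λ c∈ → let α , α∈ , eq = cov c∈ in α , α∈ , keepD eq) , cnt

    arrived : Arrived t s s′
    arrived = record
      { phase′ = phase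
      ; ref≡   = refl
      ; start≡ = refl
      ; don≡   = refl
      ; grown  = j , refl , +-monoˡ-≤ (acc s) cost-added
      ; edit   = subst (λ l → Edit 4 (output s) (don s ++ l)) (cong (λ l → _ ∷ _ ∷ l) (++-assoc (hook (left t) mu) (hook (right t) mv) (sol s)))
          (edit-insert (don s) (((left t) , w) ∷ (w′ , (right t)) ∷ hooks) (sol s)
            (s≤s (s≤s (≤-trans (≤-reflexive (length-++ (hook (left t) mu))) (+-mono-≤ (hook-length (left t) mu) (hook-length (right t) mv))))))
      }

  module _ {t : ℕ} {s : State} (P : Phase t s) (bounded : opt e t ≤ 2 * ref s) where

    centers-≤ : ∀ j → length (cen s j) * 2 ^ j ≤ 32 * ref s
    centers-≤ j = ≤-trans (Packing.packing (2 ^ j) (optimal t) (proj₁ (optimal-solves t)) (separated P j) (λ w∈ →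
        let w∈V = ∈-downFrom⁺ (proj₂ (∈-terms⁻ (cen⊆ (range P) j w∈)))
            p , p∈V , eq , le = partnered t (optimal t) (proj₂ (optimal-solves t)) w∈V
        in w∈V , p , p∈V , eq , ≤-trans (far P j w∈) le))
      (≤-trans (*-monoʳ-≤ 16 bounded) (≤-reflexive (sym (*-assoc 16 2 (ref s)))))

    -- Packing the balls against the optimum bounds the centers of a scale, and by `represented` the
    -- arrivals of that scale are at most twice as many.
    count-≤ : ∀ j → count j (scl s) * 2 ^ j ≤ 64 * ref s
    count-≤ j = let cnt = proj₂ (proj₂ (represented P j)) in begin
      count j (scl s) * 2 ^ j          ≤⟨ *-monoˡ-≤ (2 ^ j) (≤-trans (m≤m+n (count j (scl s)) (length (proj₁ (represented P j)))) cnt) ⟩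
      2 * length (cen s j) * 2 ^ j     ≡⟨ *-assoc 2 (length (cen s j)) (2 ^ j) ⟩
      2 * (length (cen s j) * 2 ^ j)   ≤⟨ *-monoʳ-≤ 2 (centers-≤ j) ⟩
      2 * (32 * ref s)                 ≡⟨ *-assoc 2 32 (ref s) ⟨
      64 * ref s                       ∎
      where open ≤-Reasoning

    -- No scale exceeds that of 4 `ref`, and `k` is chosen with at most 2 ^ `k` arrivals, so all
    -- arrivals more than `k` scales down contribute at most 4 `ref` together.
    powers-bound : ∀ k → length (scl s) ≤ 2 ^ k → 0 < ref s → ∑ (2 ^_) (scl s) ≤ k * (64 * ref s) + 4 * ref s
    powers-bound k m≤ pos = *-cancelˡ-≤ (2 ^ k) {{m^n≢0 2 k}} (begin
      2 ^ k * ∑ (2 ^_) (scl s)                                    ≤⟨ powers-≤ k h (64 * ref s) (scl s) (λ j∈ → scale-≥ 1≤4r (scl-bound P j∈)) count-≤ ⟩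
      2 ^ k * (k * (64 * ref s)) + length (scl s) * 2 ^ h         ≤⟨ +-monoʳ-≤ (2 ^ k * (k * (64 * ref s))) (*-mono-≤ m≤ (proj₁ (scale-spec 1≤4r))) ⟩
      2 ^ k * (k * (64 * ref s)) + 2 ^ k * (4 * ref s)            ≡⟨ *-distribˡ-+ (2 ^ k) (k * (64 * ref s)) (4 * ref s) ⟨
      2 ^ k * (k * (64 * ref s) + 4 * ref s)                      ∎)
      where
      open ≤-Reasoning
      1≤4r : 1 ≤ 4 * ref s
      1≤4r = ≤-trans pos (m≤m+n _ _)
      h = scale (4 * ref s)

  -- Counting recomputations and edits

  Λ : ℕ
  Λ = 1 + ⌊log₂ n ⌋

  opaque
    -- The edits charged to one pair: 2860 = 4 + 14 · 204, where 4 edges are bought on arrival and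
    -- 14 are charged for each of at most 204 `Λ` recomputations.
    rate : ℕ
    rate = 2860 * Λ

    rate≡ : rate ≡ 2860 * Λ
    rate≡ = refl

    rate-≥ : ∀ {b} → b ≤ 204 * Λ → 4 + 14 * b ≤ rate
    rate-≥ {b} b≤ = linear (4 * ⌊log₂ n ⌋) (*-monoʳ-≤ 14 b≤) (arith b ⌊log₂ n ⌋)
      where
      arith : ∀ b l → 4 + 14 * b + 14 * (204 * (1 + l)) + 4 * l ≡ 2860 * (1 + l) + 14 * b
      arith = solve-∀

  n≤2^Λ : n ≤ 2 ^ Λ
  n≤2^Λ with n ≟ 0
  ... | yes n≡0 = ≤-trans (≤-reflexive n≡0) z≤n
  ... | no n≢0  = <⇒≤ (proj₂ (log-spec n (n≢0⇒n>0 n≢0)))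

  -- rb recomputations happened in the current phase, and b edits so far.
  record Budget (s : State) (rb b : ℕ) : Set where
    field
      rebuilds : rb * ref s + acc s ≤ 3 * ∑ (2 ^_) (scl s)
      edits    : b ≤ rate * start s + (4 + 14 * rb) * length (scl s)

  open Budget

  -- Each recomputation uses up more than `ref` of the cost bought in the phase, which is at most 3
  -- (64 `Λ` + 4) `ref`. As `Λ` is at least 1, this is at most 204 `Λ` `ref`.
  rebuilds-≤ : ∀ {t s rb b} → t ≤ n → Phase t s → opt e t ≤ 2 * ref s → 0 < ref s → Budget s rb b → rb ≤ 204 * Λ
  rebuilds-≤ {t} {s} {rb} t≤n P bounded pos B = *-cancelʳ-≤ rb (204 * Λ) (ref s) {{>-nonZero pos}} (begin
    rb * ref s                                 ≤⟨ ≤-trans (m≤m+n _ (acc s)) (rebuilds B) ⟩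
    3 * ∑ (2 ^_) (scl s)                       ≤⟨ *-monoʳ-≤ 3 (powers-bound P bounded Λ m≤ pos) ⟩
    3 * (Λ * (64 * ref s) + 4 * ref s)         ≤⟨ m≤m+n _ (12 * (⌊log₂ n ⌋ * ref s)) ⟩
    3 * (Λ * (64 * ref s) + 4 * ref s) + 12 * (⌊log₂ n ⌋ * ref s) ≡⟨ arith ⌊log₂ n ⌋ (ref s) ⟩
    204 * Λ * ref s                            ∎)
    where
    open ≤-Reasoning hiding (start)
    m≤ : length (scl s) ≤ 2 ^ Λ
    m≤ = ≤-trans (≤-trans (m≤n+m _ (start s)) (≤-reflexive (scl-length P))) (≤-trans t≤n n≤2^Λ)
    arith : ∀ l r → 3 * ((1 + l) * (64 * r) + 4 * r) + 12 * (l * r) ≡ 204 * (1 + l) * r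
    arith = solve-∀

  -- Replacing the actual number of recomputations by its bound charges every pair the same `rate`,
  -- so that the count can restart with the next phase. The second alternative covers the initial
  -- state, where `ref` is 0 but no pair has arrived.
  edits-≤ : ∀ {t s rb b} → t ≤ n → Phase t s → opt e t ≤ 2 * ref s → 0 < ref s ⊎ length (scl s) ≡ 0 →
            Budget s rb b → b ≤ rate * t
  edits-≤ {t} {s} {rb} t≤n P bounded pos B = ≤-trans (edits B) (≤-trans (+-monoʳ-≤ (rate * start s) (phase-edits pos))
      (≤-reflexive (trans (sym (*-distribˡ-+ (rate) (start s) _)) (cong (rate *_) (scl-length P)))))
    where
    phase-edits : 0 < ref s ⊎ length (scl s) ≡ 0 → (4 + 14 * rb) * length (scl s) ≤ rate * length (scl s)
    phase-edits (inj₂ m≡0) rewrite m≡0 = ≤-reflexive (trans (*-zeroʳ (4 + 14 * rb)) (sym (*-zeroʳ (rate))))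
    phase-edits (inj₁ 0<r) = *-monoˡ-≤ (length (scl s)) (rate-≥ (rebuilds-≤ t≤n P bounded 0<r B))

  -- With m arrivals in the phase there are 2m terminals and at most 3m demands, hence at most 5m
  -- edges by `best-length`. The demands themselves do not change, so only the facts about `sol`
  -- need proof.
  phase-recompute : ∀ {t s} → Phase t s → opt e t ≤ 2 * ref s →
                    Phase t (record s { sol = best e (terms (start s) t) (dem s) ; acc = 0 })
                    × length (best e (terms (start s) t) (dem s)) ≤ 5 * length (scl s)
  phase-recompute {t} {s} P bounded = record
    { range       = record { start≤ = start≤ R ; don⊆ = don⊆ R ; dem⊆ = dem⊆ R ; cen⊆ = cen⊆ R ; sol⊆ = best-within e (dem⊆ R) }
    ; don-serves  = don-serves P
    ; sol-dem     = best-respects e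
    ; dem-serves  = dem-serves P
    ; dem-short   = dem-short P
    ; cost-don    = cost-don P
    ; cost-sol    = ≤-trans cheap (m≤m+n _ 0)
    ; scl-length  = scl-length P
    ; scl-bound   = scl-bound P
    ; separated   = separated P
    ; far         = far P
    ; represented = represented P
    ; length-sol  = ≤-trans short-sol (*-monoˡ-≤ (length (scl s)) {5} {9} (s≤s (s≤s (s≤s (s≤s (s≤s z≤n))))))
    ; length-dem  = length-dem P
    } , short-sol
    where
    R = range P
    m≡ : t ∸ start s ≡ length (scl s)
    m≡ = trans (cong (_∸ start s) (sym (scl-length P))) (m+n∸m≡n (start s) _)
    short-sol : length (best e (terms (start s) t) (dem s)) ≤ 5 * length (scl s)
    short-sol = ≤-trans (best-length e) (≤-trans (+-mono-≤ (≤-trans (length-terms (start s) t) (≤-reflexive (cong (2 *_) m≡))) (length-dem P))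
      (≤-reflexive (sym (*-distribʳ-+ (length (scl s)) 2 3))))
    connected : ∀ {x y} → (x , y) ∈ dem s → lab (optimal t) x ≡ lab (optimal t) y ⊎ Short x y
    connected xy∈ with dem-short P xy∈
    ... | inj₁ (i , i<t , refl) = inj₁ (proj₂ (optimal-solves t) i<t)
    ... | inj₂ sh               = inj₂ sh
    cheap : price e (best e (terms (start s) t) (dem s)) ≤ 8 * ref s
    cheap = ≤-trans (best-approx (optimal-solves t) (dem⊆ R) connected)
      (≤-trans (*-monoʳ-≤ 4 bounded) (≤-reflexive (sym (*-assoc 4 2 (ref s)))))

  -- `ref-opt` bounds `ref` by an earlier optimum; through `opt-approx` this compares the output
  -- with any solution for the current pairs.
  record Inv (t : ℕ) (s : State) : Set where
    field
      phase    : Phase t s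
      small    : acc s ≤ ref s
      bounded  : opt e t ≤ 2 * ref s
      ref-opt  : ∃[ t₀ ] t₀ ≤ t × ref s ≤ opt e t₀
      positive : 0 < ref s ⊎ length (scl s) ≡ 0

  open Inv

  -- The edit is measured from the solution `old` before the arrival. Without recomputation it
  -- consists of the at most 4 new edges; otherwise at most 9m edges leave and 5(m + 1) enter, which
  -- is within 14(m + 1), and the excess of `acc` over `ref` pays for one more recomputation.
  settle-step : ∀ {t s m rb b old} → Phase t s → opt e t ≤ 2 * ref s → 0 < ref s →
    (∃[ t₀ ] t₀ ≤ t × ref s ≤ opt e t₀) →
    length (scl s) ≡ suc m → length old ≤ 9 * m → Edit 4 (don s ++ old) (output s) →
    rb * ref s + acc s ≤ 3 * ∑ (2 ^_) (scl s) → b ≤ rate * start s + (4 + 14 * rb) * m →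
    Inv t (settle e t s) × ∃[ k ] ∃[ rb′ ] Edit k (don s ++ old) (output (settle e t s)) × Budget (settle e t s) rb′ (b + k)
  settle-step {t} {s} {m} {rb} {b} {old} P bnd pos ro m≡ old≤ edit reb bud with acc s ≤? ref s
  ... | yes le = record { phase = P ; small = le ; bounded = bnd ; ref-opt = ro ; positive = inj₁ pos }
      , 4 , rb , edit , record
        { rebuilds = reb
        ; edits    = subst (λ l → b + 4 ≤ rate * start s + (4 + 14 * rb) * l) (sym m≡)
                       (linear (14 * rb) bud (arith b (rate * start s) rb m)) }
    where
    arith : ∀ b q r m → b + 4 + (q + (4 + 14 * r) * m) + 14 * r ≡ q + (4 + 14 * r) * suc m + b
    arith = solve-∀
  ... | no ≰ = record { phase = P′ ; small = z≤n ; bounded = bnd ; ref-opt = ro ; positive = inj₁ pos }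
      , 14 * suc m , suc rb
      , edit-replace (don s) old E lens , record
        { rebuilds = ≤-trans (linear 0 (<⇒≤ (≰⇒> ≰)) (arith₀ rb (ref s) (acc s))) reb
        ; edits    = subst (λ l → b + 14 * suc m ≤ rate * start s + (4 + 14 * suc rb) * l) (sym m≡)
                       (linear (4 + 14 * rb) bud (arith b (rate * start s) rb m)) }
    where
    E = best e (terms (start s) t) (dem s)
    P′ = proj₁ (phase-recompute P bnd)
    lens : length E + length old ≤ 14 * suc m
    lens = ≤-trans (+-mono-≤ {length E} {5 * suc m} {length old} {9 * suc m}
      (≤-trans (proj₂ (phase-recompute P bnd)) (≤-reflexive (cong (5 *_) m≡)))
      (≤-trans old≤ (*-monoʳ-≤ 9 (n≤1+n m)))) (≤-reflexive (sym (*-distribʳ-+ (suc m) 5 9)))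
    arith₀ : ∀ b r a → suc b * r + 0 + a + 0 ≡ b * r + a + r
    arith₀ = solve-∀
    arith : ∀ b q r m → b + 14 * suc m + (q + (4 + 14 * r) * m) + (4 + 14 * r) ≡ q + (4 + 14 * suc r) * suc m + b
    arith = solve-∀

  module _ {t : ℕ} (t<n : t < n) where
    private
      uv>0 : 1 ≤ e (2 * t) (suc (2 * t))
      uv>0 = e-pos (2i<2t t<n) (1+2i<2t t<n) (λ u≡v → 1+n≢n (sym u≡v))

      detour>0 : ∀ {s p} → Link t s p → 1 ≤ detour e t p
      detour>0 direct           = ≤-trans uv>0 (m≤m+n _ _)
      detour>0 (via {w} w∈ _ _) = let _ , w<u = ∈-terms⁻ w∈ in
        ≤-trans (e-pos (2i<2t t<n) (<-trans w<u (2i<2t t<n)) (λ u≡w → <-irrefl (sym u≡w) w<u)) (m≤m+n _ _)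

      attached : ∀ {s w w′} → Phase t s → opt e (suc t) ≤ 2 * ref s → Link t s (w , w′) →
        (∀ {p} → p ∈ (suc (2 * t) , suc (2 * t)) ∷ joints t s → detour e t (w , w′) ≤ detour e t p) →
        Arrived t s (attach e t s (w , w′) (detour e t (w , w′)))
      attached {s} {w} {w′} P bnd linked least =
        Arrival.arrived {t} {s} {w} {w′} {ℓ} {j} {near e (2 ^ j) (2 * t) (cen s j)} {near e (2 ^ j) (suc (2 * t)) (cen s j)}
          P linked refl
          (λ {c} {c′} c∈ c′∈ eq → least {c , c′} (there (∈-joints⁺ {s = s} c∈ c′∈ eq)))
          (≤-trans (least (here refl)) (≤-reflexive (trans (cong (e (2 * t) (suc (2 * t)) +_) (e-refl (suc (2 * t)))) (+-identityʳ _))))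
          (scale-spec (detour>0 linked)) bnd (near-spec e (2 ^ j) (2 * t) (cen s j)) (near-spec e (2 ^ j) (suc (2 * t)) (cen s j))
        where
        ℓ = detour e t (w , w′)
        j = scale ℓ

    arrive-arrived : ∀ {s} → Phase t s → opt e (suc t) ≤ 2 * ref s → Arrived t s (arrive e t s)
    arrive-arrived {s} P bnd = attached P bnd (link-spec e t s) (link-≤ e t s)

    positive-ref : ∀ {r} → opt e (suc t) ≤ 2 * r → 0 < r
    positive-ref {zero}  bnd with () ← ≤-trans uv>0 (≤-trans (width≤opt {t} {suc t} ≤-refl) (*-monoʳ-≤ 2 bnd))
    positive-ref {suc r} bnd = s≤s z≤n

    settle-arrived : ∀ {s s′ rb b} → Phase t s → Arrived t s s′ → opt e (suc t) ≤ 2 * ref s →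
      (∃[ t₀ ] t₀ ≤ suc t × ref s ≤ opt e t₀) → Budget s rb b →
      Inv (suc t) (settle e (suc t) s′) ×
      ∃[ k ] ∃[ rb′ ] Edit k (output s) (output (settle e (suc t) s′)) × Budget (settle e (suc t) s′) rb′ (b + k)
    settle-arrived {s} {s′@(state .(don s) .(start s) .(ref s) _ _ _ .(j ∷ scl s) _)} {rb} {b} P
      record { phase′ = P′ ; ref≡ = refl ; start≡ = refl ; don≡ = refl ; grown = j , refl , cheap ; edit = ed } bnd ro B =
      settle-step {suc t} {s′} {length (scl s)} {rb} {b} {sol s} P′ bnd (positive-ref bnd) ro refl (length-sol P) ed
        (linear 0 (+-mono-≤ (rebuilds B) cheap) (arith rb (ref s) (acc s′) (acc s) (2 ^ j) (∑ (2 ^_) (scl s)))) (edits B)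
      where
      arith : ∀ b r a′ a p q → b * r + a′ + (3 * q + (3 * p + a)) + 0 ≡ 3 * (p + q) + (b * r + a + a′)
      arith = solve-∀

    step-phase : ∀ {s rb b} → Phase t s → opt e (suc t) ≤ 2 * ref s →
      (∃[ t₀ ] t₀ ≤ suc t × ref s ≤ opt e t₀) → Budget s rb b →
      Inv (suc t) (settle e (suc t) (arrive e t s)) ×
      ∃[ k ] ∃[ rb′ ] Edit k (output s) (output (settle e (suc t) (arrive e t s))) × Budget (settle e (suc t) (arrive e t s)) rb′ (b + k)
    step-phase P bnd ro B = settle-arrived P (arrive-arrived P bnd) bnd ro B

  enter-cases : ∀ t s → opt e (suc t) ≤ 2 * ref s × enter e t s ≡ s ⊎
                        2 * ref s < opt e (suc t) × enter e t s ≡ fresh t (opt e (suc t)) s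
  enter-cases t s = cases (opt e (suc t) ≤? 2 * ref s)
    where
    cases : (d : Dec (opt e (suc t) ≤ 2 * ref s)) →
            opt e (suc t) ≤ 2 * ref s × decide d s (fresh t (opt e (suc t)) s) ≡ s ⊎
            2 * ref s < opt e (suc t) × decide d s (fresh t (opt e (suc t)) s) ≡ fresh t (opt e (suc t)) s
    cases (yes le) = inj₁ (le , refl)
    cases (no ≰)   = inj₂ (≰⇒> ≰ , refl)

  Next : ℕ → ℕ → State → State → Set
  Next t b s s₁ = Inv (suc t) s′ × ∃[ k ] ∃[ rb ] Edit k (output s) (output s′) × Budget s′ rb (b + k)
    where s′ = settle e (suc t) (arrive e t s₁)

  next : ∀ {t s rb b} → t < n → Inv t s → Budget s rb b → Next t b s (enter e t s)
  next {t} {s} {rb} {b} t<n I B with enter-cases t s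
  ... | inj₁ (le , eq) = subst (Next t b s) (sym eq)
    (step-phase t<n (phase I) le (let t₀ , t₀≤ , r≤ = ref-opt I in t₀ , m≤n⇒m≤1+n t₀≤ , r≤) B)
  -- Opening a phase moves all edges to `don` and leaves the output unchanged up to appending the
  -- empty list.
  ... | inj₂ (gt , eq) = subst (Next t b s) (sym eq)
    (I′ , k , rb′ , subst (λ l → Edit k l (output s′)) (++-identityʳ (output s)) edit , B′)
    where
    s′ = settle e (suc t) (arrive e t (fresh t (opt e (suc t)) s))
    reset : Budget (fresh t (opt e (suc t)) s) 0 b
    reset = record { rebuilds = z≤n
                   ; edits    = ≤-trans (edits-≤ (<⇒≤ t<n) (phase I) (bounded I) (positive I) B) (m≤m+n _ _) }
    result : Next t b (fresh t (opt e (suc t)) s) (fresh t (opt e (suc t)) s)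
    result = step-phase t<n (phase-fresh (phase I) (small I) gt) (m≤m+n _ _) (suc t , ≤-refl , ≤-refl) reset
    I′ = proj₁ result
    k = proj₁ (proj₂ result)
    rb′ = proj₁ (proj₂ (proj₂ result))
    edit = proj₁ (proj₂ (proj₂ (proj₂ result)))
    B′ = proj₂ (proj₂ (proj₂ (proj₂ result)))

  run-invariant : ∀ t → t ≤ n → Inv t (stateAt e t) × ∃[ b ] ∃[ rb ] Edits e t b × Budget (stateAt e t) rb b
  run-invariant zero _ =
    record { phase = phase-init ; small = z≤n ; bounded = ≤-reflexive opt-zero ; ref-opt = 0 , z≤n , z≤n ; positive = inj₂ refl }
    , 0 , 0 , zero , record { rebuilds = z≤n ; edits = z≤n }
  run-invariant (suc t) t<n =
    let I , b , rb , E , B       = run-invariant t (<⇒≤ t<n)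
        I′ , k , rb′ , edit , B′ = next t<n I B
    in I′ , b + k , rb′ , suc E edit , B′

-- Rounding and edge sets

ι : ℕ → ℚ
ι k = mkℚ (posℤ k) 0 (Coprime.sym (1-coprimeTo k))

ι-mono : ∀ {a b} → a ≤ b → ι a ℚ.≤ ι b
ι-mono a≤b = ℚ.*≤* (ℤ.*-monoʳ-≤-nonNeg (posℤ 1) (ℤ.+≤+ a≤b))

ι-cancel : ∀ {a b} → ι a ℚ.≤ ι b → a ≤ b
ι-cancel {a} {b} (ℚ.*≤* le) = ℤ.drop‿+≤+ (subst₂ ℤ._≤_ (ℤ.*-identityʳ (posℤ a)) (ℤ.*-identityʳ (posℤ b)) le)

ι-+ : ∀ a b → ι (a + b) ≡ ι a ℚ.+ ι b
ι-+ a b = ℚ.toℚᵘ-injective (ℚᵘ.≃-trans (ℚᵘ.*≡* (cong₂ ℤ._*_ eq refl)) (ℚᵘ.≃-sym (ℚ.toℚᵘ-homo-+ (ι a) (ι b))))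
  where
  eq : posℤ (a + b) ≡ posℤ a ℤ.* posℤ 1 ℤ.+ posℤ b ℤ.* posℤ 1
  eq = sym (cong₂ ℤ._+_ (ℤ.*-identityʳ (posℤ a)) (ℤ.*-identityʳ (posℤ b)))

ι-* : ∀ a b → ι (a * b) ≡ ι a ℚ.* ι b
ι-* a b = ℚ.toℚᵘ-injective (ℚᵘ.≃-trans (ℚᵘ.*≡* (cong₂ ℤ._*_ (ℤ.pos-* a b) refl)) (ℚᵘ.≃-sym (ℚ.toℚᵘ-homo-* (ι a) (ι b))))

-- Rounding up; distances at least 1 at most double, and the triangle inequality survives.
up : ℚ → ℕ
up (mkℚ (posℤ k) d-1 _)    = (k + d-1) / suc d-1
up (mkℚ -[1+ _ ] _ _)   = 0

up-≥ : ∀ q → q ℚ.≤ ι (up q)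
up-≥ (mkℚ (posℤ k) d-1 _) = ℚ.*≤* (subst₂ ℤ._≤_ (sym (ℤ.*-identityʳ (posℤ k))) (ℤ.pos-* u (suc d-1)) (ℤ.+≤+ k≤))
  where
  u = (k + d-1) / suc d-1
  k≤ : k ≤ u * suc d-1
  k≤ = +-cancelʳ-≤ (suc d-1) k _ (≤-trans (≤-reflexive (+-suc k d-1))
         (≤-trans (s≤s (≤-reflexive (m≡m%n+[m/n]*n (k + d-1) (suc d-1))))
         (≤-trans (+-monoˡ-≤ (u * suc d-1) (m%n<n (k + d-1) (suc d-1))) (≤-reflexive (+-comm (suc d-1) (u * suc d-1))))))
up-≥ (mkℚ -[1+ _ ] _ _) = ℚ.*≤* ℤ.-≤+

up-least : ∀ q {m} → q ℚ.≤ ι m → up q ≤ m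
up-least (mkℚ (posℤ k) d-1 _) {m} (ℚ.*≤* le) = ≤-pred (m<n*o⇒m/o<n {k + d-1} {suc m} {suc d-1} bound)
  where
  k≤ : k ≤ m * suc d-1
  k≤ = ℤ.drop‿+≤+ (subst₂ ℤ._≤_ (ℤ.*-identityʳ (posℤ k)) (sym (ℤ.pos-* m (suc d-1))) le)
  bound : suc (k + d-1) ≤ suc m * suc d-1
  bound = ≤-trans (≤-reflexive (sym (+-suc k d-1))) (≤-trans (+-monoˡ-≤ (suc d-1) k≤) (≤-reflexive (+-comm (m * suc d-1) (suc d-1))))
up-least (mkℚ -[1+ _ ] _ _) le = z≤n

-- Since `up` is the least upper integer, its predecessor lies below `q`, and the remaining 1 is at
-- most `q` as well.
up-double : ∀ {q} → 1ℚ ℚ.≤ q → ι (up q) ℚ.≤ q ℚ.+ q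
up-double {q} 1≤q with up q in eq
... | zero  = ℚ.≤-trans (ℚ.≤-trans (ι-mono {0} {1} z≤n) 1≤q) (ℚ.≤-trans (ℚ.≤-reflexive (sym (ℚ.+-identityʳ q)))
                (ℚ.+-monoʳ-≤ q (ℚ.≤-trans (ι-mono {0} {1} z≤n) 1≤q)))
... | suc m with ℚ.≤-total q (ι m)
...   | inj₁ q≤m = ⊥-elim (1+n≰n (subst (_≤ m) eq (up-least q q≤m)))
...   | inj₂ m≤q = ℚ.≤-trans (ℚ.≤-reflexive (ι-+ 1 m)) (ℚ.+-mono-≤ 1≤q m≤q)

up-+ : ∀ {p q r} → r ℚ.≤ p ℚ.+ q → up r ≤ up p + up q
up-+ {p} {q} {r} r≤ = up-least r (ℚ.≤-trans r≤ (ℚ.≤-trans (ℚ.+-mono-≤ (up-≥ p) (up-≥ q)) (ℚ.≤-reflexive (sym (ι-+ (up p) (up q))))))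

up-pos : ∀ {q} → 1ℚ ℚ.≤ q → 1 ≤ up q
up-pos {q} 1≤q = ι-cancel (ℚ.≤-trans 1≤q (up-≥ q))

sumℕ-mono : ∀ k {f g} → (∀ i → i < k → f i ≤ g i) → sumℕ k f ≤ sumℕ k g
sumℕ-mono zero    f≤g = z≤n
sumℕ-mono (suc k) f≤g = +-mono-≤ (sumℕ-mono k (λ i i<k → f≤g i (m≤n⇒m≤1+n i<k))) (f≤g k ≤-refl)

sumℕ-zero : ∀ k → sumℕ k (λ _ → 0) ≡ 0
sumℕ-zero zero    = refl
sumℕ-zero (suc k) rewrite sumℕ-zero k = refl

sumℕ-∑ : ∀ {A : Set} k (f : ℕ → A → ℕ) xs → sumℕ k (λ i → ∑ (f i) xs) ≡ ∑ (λ x → sumℕ k (λ i → f i x)) xs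
sumℕ-∑ zero    f xs = sym (∑-0 xs)
sumℕ-∑ (suc k) f xs = trans (cong (_+ ∑ (f k) xs) (sumℕ-∑ k f xs)) (sym (∑-+ (λ x → sumℕ k (λ i → f i x)) (f k) xs))

sumℕ-single : ∀ k i c → sumℕ k (λ x → decide (x ≟ i) c 0) ≤ c
sumℕ-single k i c = proj₁ (go k)
  where
  go : ∀ k → sumℕ k (λ x → decide (x ≟ i) c 0) ≤ c × (k ≤ i → sumℕ k (λ x → decide (x ≟ i) c 0) ≡ 0)
  go zero    = z≤n , λ _ → refl
  go (suc k) with le , vanish ← go k with k ≟ i
  ... | yes refl rewrite vanish ≤-refl = ≤-refl , λ k<k → ⊥-elim (<-irrefl refl k<k)
  ... | no _     rewrite +-identityʳ (sumℕ k (λ x → decide (x ≟ i) c 0)) = le , λ k<i → vanish (<⇒≤ k<i)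

sumℚ-≤ : ∀ k {f g} → (∀ i → i < k → f i ℚ.≤ ι (g i)) → sumℚ k f ℚ.≤ ι (sumℕ k g)
sumℚ-≤ zero    f≤g = ι-mono {0} {0} z≤n
sumℚ-≤ (suc k) {g = g} f≤g = ℚ.≤-trans (ℚ.+-mono-≤ (sumℚ-≤ k (λ i i<k → f≤g i (m≤n⇒m≤1+n i<k))) (f≤g k ≤-refl))
  (ℚ.≤-reflexive (sym (ι-+ (sumℕ k g) (g k))))

sumℚ-double : ∀ k {f g} → (∀ i → i < k → ι (g i) ℚ.≤ f i ℚ.+ f i) → ι (sumℕ k g) ℚ.≤ sumℚ k f ℚ.+ sumℚ k f
sumℚ-double zero    g≤f = ι-mono {0} {0} z≤n
sumℚ-double (suc k) {f} {g} g≤f = ℚ.≤-trans (ℚ.≤-reflexive (ι-+ (sumℕ k g) (g k)))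
  (ℚ.≤-trans (ℚ.+-mono-≤ (sumℚ-double k (λ i i<k → g≤f i (m≤n⇒m≤1+n i<k))) (g≤f k ≤-refl))
    (ℚ.≤-reflexive (interchange (sumℚ k f) (sumℚ k f) (f k) (f k))))
  where open import Algebra.Properties.CommutativeSemigroup (CommutativeMonoid.commutativeSemigroup ℚ.+-0-commutativeMonoid) using (interchange)

sum₂ : ℕ → (ℕ → ℕ → ℕ) → ℕ
sum₂ M f = sumℕ M λ y → sumℕ y λ x → f x y

-- List edges may have either orientation, whereas an edge set is read only in the triangle x < y.
-- The value of an edge is put into the cell given by its smaller and larger end.
slot : (Edge → ℕ) → Edge → ℕ → ℕ → ℕ
slot g (a , b) x y = decide (y ≟ a ⊔ b) (decide (x ≟ a ⊓ b) (g (a , b)) 0) 0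

slot-hit : ∀ g {x y} → x < y → ∀ {a b} → (x ≡ a × y ≡ b) ⊎ (y ≡ a × x ≡ b) → slot g (a , b) x y ≡ g (a , b)
slot-hit g {x} {y} x<y {a} {b} eq with y ≟ a ⊔ b | x ≟ a ⊓ b | eq
... | yes _ | yes _ | _ = refl
... | no ≢  | _     | inj₁ (refl , refl) = ⊥-elim (≢ (sym (m≤n⇒m⊔n≡n (<⇒≤ x<y))))
... | no ≢  | _     | inj₂ (refl , refl) = ⊥-elim (≢ (sym (m≥n⇒m⊔n≡m (<⇒≤ x<y))))
... | yes _ | no ≢  | inj₁ (refl , refl) = ⊥-elim (≢ (sym (m≤n⇒m⊓n≡m (<⇒≤ x<y))))
... | yes _ | no ≢  | inj₂ (refl , refl) = ⊥-elim (≢ (sym (m≥n⇒m⊓n≡n (<⇒≤ x<y))))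

sum₂-slot : ∀ M g p → sum₂ M (slot g p) ≤ g p
sum₂-slot M g p@(a , b) = ≤-trans (sumℕ-mono M (λ y _ → inner y)) (sumℕ-single M (a ⊔ b) (g p))
  where
  inner : ∀ y → sumℕ y (λ x → slot g p x y) ≤ decide (y ≟ a ⊔ b) (g p) 0
  inner y with y ≟ a ⊔ b
  ... | yes _ = sumℕ-single y (a ⊓ b) (g p)
  ... | no _  = ≤-reflexive (sumℕ-zero y)

Joins : List Edge → ℕ → ℕ → Set
Joins l x y = (x , y) ∈ l ⊎ (y , x) ∈ l

-- Every marked cell is charged to a list entry with these ends; repeated entries only increase the
-- right-hand side.
sum₂-≤ : ∀ M (h : ℕ → ℕ → Bool) (g : Edge → ℕ) → (∀ x y → g (x , y) ≡ g (y , x)) → ∀ l →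
         (∀ x y → h x y ≡ true → x < y × Joins l x y) →
         sum₂ M (λ x y → if h x y then g (x , y) else 0) ≤ ∑ g l
sum₂-≤ M h g g-sym l covered = begin
  sum₂ M (λ x y → if h x y then g (x , y) else 0)  ≤⟨ sumℕ-mono M (λ y _ → sumℕ-mono y (λ x _ → pointwise x y)) ⟩
  sum₂ M (λ x y → ∑ (λ p → slot g p x y) l)        ≡⟨ swapped M ⟩
  ∑ (λ p → sum₂ M (slot g p)) l                    ≤⟨ ∑-mono l (λ {p} _ → sum₂-slot M g p) ⟩
  ∑ g l                                            ∎
  where
  open ≤-Reasoning
  pointwise : ∀ x y → (if h x y then g (x , y) else 0) ≤ ∑ (λ p → slot g p x y) l
  pointwise x y with h x y in eq
  ... | false = z≤n
  ... | true with covered x y eq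
  ...   | x<y , inj₁ xy∈ = ≤-trans (≤-reflexive (sym (slot-hit g x<y (inj₁ (refl , refl))))) (∑-∈ (λ p → slot g p x y) xy∈)
  ...   | x<y , inj₂ yx∈ = ≤-trans (≤-reflexive (trans (g-sym x y) (sym (slot-hit g x<y (inj₂ (refl , refl)))))) (∑-∈ (λ p → slot g p x y) yx∈)
  swapped : ∀ M → sum₂ M (λ x y → ∑ (λ p → slot g p x y) l) ≡ ∑ (λ p → sum₂ M (slot g p)) l
  swapped zero    = sym (∑-0 l)
  swapped (suc M) = trans (cong₂ _+_ (swapped M) (sumℕ-∑ M (λ x p → slot g p x M) l))
    (sym (∑-+ (λ p → sum₂ M (slot g p)) (λ p → sumℕ M (λ x → slot g p x M)) l))

open DecMembership (≡-dec _≟_ _≟_) using (_∈?_)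

opaque

  toSet : List Edge → EdgeSet
  toSet l x y = does ((x , y) ∈? l) ∨ does ((y , x) ∈? l)

  toSet⁻ : ∀ l x y → toSet l x y ≡ true → Joins l x y
  toSet⁻ l x y eq with (x , y) ∈? l | (y , x) ∈? l
  ... | yes xy∈ | _       = inj₁ xy∈
  ... | no _    | yes yx∈ = inj₂ yx∈

  toSet⁺ : ∀ l x y → Joins l x y → toSet l x y ≡ true
  toSet⁺ l x y j with (x , y) ∈? l | (y , x) ∈? l | j
  ... | yes _ | _     | _        = refl
  ... | no _  | yes _ | _        = refl
  ... | no ∉  | no _  | inj₁ xy∈ = ⊥-elim (∉ xy∈)
  ... | no _  | no ∉  | inj₂ yx∈ = ⊥-elim (∉ yx∈)

  toSet-[] : (λ _ _ → false) ≡ toSet []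
  toSet-[] = refl

∧-true : ∀ {a b} → a ∧ b ≡ true → a ≡ true × b ≡ true
∧-true {true} {true} _ = refl , refl

<ᵇ-true⁻ : ∀ {m n} → (m <ᵇ n) ≡ true → m < n
<ᵇ-true⁻ {m} {n} eq = <ᵇ⇒< m n (subst 𝔹.T (sym eq) _)

<ᵇ-true⁺ : ∀ {m n} → m < n → (m <ᵇ n) ≡ true
<ᵇ-true⁺ {m} {n} lt with m <ᵇ n | <⇒<ᵇ lt
... | true | _ = refl

edgeAt⁻ : ∀ t F x y → edgeAt t F x y ≡ true → x < y × y < 2 * t × F x y ≡ true
edgeAt⁻ t F x y eq = let range , Fxy = ∧-true eq ; lt , lt′ = ∧-true range in <ᵇ-true⁻ lt , <ᵇ-true⁻ lt′ , Fxy

edgeAt⁺ : ∀ t F x y → x < y → y < 2 * t → F x y ≡ true → edgeAt t F x y ≡ true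
edgeAt⁺ t F x y lt lt′ Fxy rewrite <ᵇ-true⁺ lt | <ᵇ-true⁺ lt′ = Fxy

Conn-trans : ∀ {t E a b c} → Conn t E a b → Conn t E b c → Conn t E a c
Conn-trans p here       = p
Conn-trans p (step q r) = step (Conn-trans p q) r

Conn-sym : ∀ {t E a b} → Conn t E a b → Conn t E b a
Conn-sym here              = here
Conn-sym (step p (inj₁ r)) = Conn-trans (step here (inj₂ r)) (Conn-sym p)
Conn-sym (step p (inj₂ r)) = Conn-trans (step here (inj₁ r)) (Conn-sym p)

connEquivalence : ∀ t E → IsEquivalence (Conn t E)
connEquivalence t E = record { refl = here ; sym = Conn-sym ; trans = Conn-trans }

toSet-conn : ∀ {t l} → Within (_< 2 * t) l → ∀ {x y} → lab l x ≡ lab l y → Conn t (toSet l) x y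
toSet-conn {t} {l} l⊆ = lab-least (connEquivalence t (toSet l)) {l} edge
  where
  edge : ∀ {a b} → (a , b) ∈ l → Conn t (toSet l) a b
  edge {a} {b} ab∈ with <-cmp a b
  ... | tri< a<b _ _  = step here (inj₁ (edgeAt⁺ t (toSet l) a b a<b (proj₂ (l⊆ ab∈)) (toSet⁺ l a b (inj₁ ab∈))))
  -- A loop, as left by a direct link, connects nothing new.
  ... | tri≈ _ refl _ = here
  ... | tri> _ _ b<a  = step here (inj₂ (edgeAt⁺ t (toSet l) b a b<a (proj₁ (l⊆ ab∈)) (toSet⁺ l b a (inj₂ ab∈))))

row : ℕ → EdgeSet → ℕ → ℕ → List Edge
row t G y zero    = []
row t G y (suc k) = (if edgeAt t G k y then [ k , y ] else []) ++ row t G y k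

rows : ℕ → EdgeSet → ℕ → List Edge
rows t G zero    = []
rows t G (suc M) = row t G M M ++ rows t G M

fromSet : ℕ → EdgeSet → List Edge
fromSet t G = rows t G (2 * t)

row-cost : ∀ e t G y k → price e (row t G y k) ≡ sumℕ k (λ x → if edgeAt t G x y then e x y else 0)
row-cost e t G y zero    = refl
row-cost e t G y (suc k) = trans (∑-++ (len e) (if edgeAt t G k y then [ k , y ] else []))
  (trans (cong₂ _+_ (head (edgeAt t G k y)) (row-cost e t G y k)) (+-comm _ (sumℕ k _)))
  where
  head : ∀ b → price e (if b then [ k , y ] else []) ≡ (if b then e k y else 0)
  head true  = +-identityʳ (e k y)
  head false = refl

rows-cost : ∀ e t G M → price e (rows t G M) ≡ sum₂ M (λ x y → if edgeAt t G x y then e x y else 0)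
rows-cost e t G zero    = refl
rows-cost e t G (suc M) = trans (∑-++ (len e) (row t G M M))
  (trans (cong₂ _+_ (row-cost e t G M M) (rows-cost e t G M)) (+-comm _ (sum₂ M _)))

∈-row⁺ : ∀ t G y k {x} → x < k → edgeAt t G x y ≡ true → (x , y) ∈ row t G y k
∈-row⁺ t G y (suc k) {x} x<k eq with m≤n⇒m<n∨m≡n (≤-pred x<k)
... | inj₁ x<k′ = ∈-++⁺ʳ (if edgeAt t G k y then [ k , y ] else []) (∈-row⁺ t G y k x<k′ eq)
... | inj₂ refl rewrite eq = here refl

∈-rows⁺ : ∀ t G M {x y} → x < y → y < M → edgeAt t G x y ≡ true → (x , y) ∈ rows t G M
∈-rows⁺ t G (suc M) {x} {y} x<y y<M eq with m≤n⇒m<n∨m≡n (≤-pred y<M)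
... | inj₁ y<M′ = ∈-++⁺ʳ (row t G M M) (∈-rows⁺ t G M x<y y<M′ eq)
... | inj₂ refl = ∈-++⁺ˡ (∈-row⁺ t G M M x<y eq)

∈-row⁻ : ∀ t G y k {a b} → (a , b) ∈ row t G y k → b ≡ y × a < k
∈-row⁻ t G y (suc k) ab∈ with edgeAt t G k y
∈-row⁻ t G y (suc k) (here refl) | true  = refl , ≤-refl
∈-row⁻ t G y (suc k) (there ab∈) | true  = let eq , lt = ∈-row⁻ t G y k ab∈ in eq , m≤n⇒m≤1+n lt
∈-row⁻ t G y (suc k) ab∈         | false = let eq , lt = ∈-row⁻ t G y k ab∈ in eq , m≤n⇒m≤1+n lt

rows-within : ∀ t G M → Within (_< M) (rows t G M)
rows-within t G (suc M) ab∈ with ∈-++⁻ (row t G M M) ab∈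
... | inj₁ ab∈r with refl , a< ← ∈-row⁻ t G M M ab∈r = m≤n⇒m≤1+n a< , ≤-refl
... | inj₂ ab∈s = let a< , b< = rows-within t G M ab∈s in m≤n⇒m≤1+n a< , m≤n⇒m≤1+n b<

fromSet-conn : ∀ {t G x y} → Conn t G x y → lab (fromSet t G) x ≡ lab (fromSet t G) y
fromSet-conn here = refl
fromSet-conn {t} {G} (step {b} {c} p (inj₁ r)) = let lt , lt′ , _ = edgeAt⁻ t G b c r in
  trans (fromSet-conn p) (lab-edge (∈-rows⁺ t G (2 * t) lt lt′ r))
fromSet-conn {t} {G} (step {b} {c} p (inj₂ r)) = let lt , lt′ , _ = edgeAt⁻ t G c b r in
  trans (fromSet-conn p) (sym (lab-edge (∈-rows⁺ t G (2 * t) lt lt′ r)))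

-- The algorithm for rational distances and its guarantees

round : Dist → Metric
round d x y = up (d x y)

solution : State → EdgeSet
solution s = toSet (output s)

algorithm : OnlineAlg
algorithm t d = solution (stateAt (round d) t)

algorithm-online : ∀ t {d e} → AgreeOn (terms 0 t) (round d) e → algorithm t d ≡ solution (stateAt e t)
algorithm-online t agree = cong solution (stateAt-cong t agree)

-- A cell in which the two sets differ holds an edge of one list that is absent from the other, so
-- it belongs to the insertions or deletions of the edit. The range conditions exclude that an edge
-- is missing merely because `edgeAt` ignores it.
changes-≤ : ∀ {A d s k l l′} → run A d s ≡ toSet l → run A d (suc s) ≡ toSet l′ →
            Within (_< 2 * s) l → Within (_< 2 * suc s) l′ → Edit k l l′ → changes A d s ≤ k
changes-≤ {A} {d} {s} {k} {l} {l′} run≡l run≡l′ l⊆ l′⊆ (I , R , toNew , toOld , le) = begin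
  changes A d s              ≡⟨ cong₂ (λ F F′ → sum₂ (2 * suc s) λ x y → if edgeAt s F x y xor edgeAt (suc s) F′ x y then 1 else 0) run≡l run≡l′ ⟩
  sum₂ (2 * suc s) (λ x y → if h x y then 1 else 0) ≤⟨ sum₂-≤ (2 * suc s) h (λ _ → 1) (λ _ _ → refl) (I ++ R) changed ⟩
  ∑ (λ _ → 1) (I ++ R)       ≡⟨ trans (∑-const 1 (I ++ R)) (*-identityʳ _) ⟩
  length (I ++ R)            ≡⟨ length-++ I ⟩
  length I + length R        ≤⟨ le ⟩
  k                          ∎
  where
  open ≤-Reasoning
  h : ℕ → ℕ → Bool
  h x y = edgeAt s (toSet l) x y xor edgeAt (suc s) (toSet l′) x y
  present : ∀ t l {x y} → edgeAt t (toSet l) x y ≡ true → x < y × Joins l x y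
  present t l {x} {y} eq = let lt , _ , ∈l = edgeAt⁻ t (toSet l) x y eq in lt , toSet⁻ l x y ∈l
  bound : ∀ t {l x y} → Within (_< 2 * t) l → Joins l x y → y < 2 * t
  bound t l⊆ (inj₁ xy∈) = proj₂ (l⊆ xy∈)
  bound t l⊆ (inj₂ yx∈) = proj₁ (l⊆ yx∈)
  absent : ∀ t l {x y} → Within (_< 2 * t) l → x < y → edgeAt t (toSet l) x y ≡ false → ¬ Joins l x y
  absent t l {x} {y} l⊆ lt eq j with () ← trans (sym eq) (edgeAt⁺ t (toSet l) x y lt (bound t l⊆ j) (toSet⁺ l x y j))
  new : ∀ {l L L′ x y} → (∀ {p} → p ∈ l → p ∈ L ++ L′) → Joins l x y → ¬ Joins L′ x y → Joins L x y
  new {L = L} f (inj₁ xy∈) ∉ with ∈-++⁻ L (f xy∈)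
  ... | inj₁ ∈L  = inj₁ ∈L
  ... | inj₂ ∈L′ = ⊥-elim (∉ (inj₁ ∈L′))
  new {L = L} f (inj₂ yx∈) ∉ with ∈-++⁻ L (f yx∈)
  ... | inj₁ ∈L  = inj₂ ∈L
  ... | inj₂ ∈L′ = ⊥-elim (∉ (inj₂ ∈L′))
  inI : ∀ {x y} → Joins I x y → Joins (I ++ R) x y
  inI (inj₁ p) = inj₁ (∈-++⁺ˡ p)
  inI (inj₂ p) = inj₂ (∈-++⁺ˡ p)
  inR : ∀ {x y} → Joins R x y → Joins (I ++ R) x y
  inR (inj₁ p) = inj₁ (∈-++⁺ʳ I p)
  inR (inj₂ p) = inj₂ (∈-++⁺ʳ I p)
  changed : ∀ x y → h x y ≡ true → x < y × Joins (I ++ R) x y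
  changed x y eq with edgeAt s (toSet l) x y in eq₁ | edgeAt (suc s) (toSet l′) x y in eq₂
  ... | true | false = let lt , j = present s l eq₁ in lt , inR (new toOld j (absent (suc s) l′ l′⊆ lt eq₂))
  ... | false | true = let lt , j = present (suc s) l′ eq₂ in lt , inI (new toNew j (absent s l l⊆ lt eq₁))

module Guarantee (n : ℕ) (0<n : 0 < n) (d : Dist) (metric : IsTerminalMetric n d) where

  d-refl = proj₁ metric
  d-sym  = proj₁ (proj₂ metric)
  d-tri  = proj₁ (proj₂ (proj₂ metric))
  d-≥1   = proj₂ (proj₂ (proj₂ metric))

  0<2n : 0 < 2 * n
  0<2n = ≤-trans 0<n (m≤m+n n _)

  clamp : ℕ → ℕ
  clamp x = decide (x <? 2 * n) x 0

  clamp< : ∀ x → clamp x < 2 * n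
  clamp< x with x <? 2 * n
  ... | yes x< = x<
  ... | no _   = 0<2n

  clamp-id : ∀ {x} → x < 2 * n → clamp x ≡ x
  clamp-id {x} x< with x <? 2 * n
  ... | yes _ = refl
  ... | no x≮ = ⊥-elim (x≮ x<)

  -- Rounded distances; terminals that never arrive are identified with terminal 0, so that the axioms hold everywhere.
  e : Metric
  e x y = up (d (clamp x) (clamp y))

  e-id : ∀ {x y} → x < 2 * n → y < 2 * n → e x y ≡ up (d x y)
  e-id x< y< = cong₂ (λ x y → up (d x y)) (clamp-id x<) (clamp-id y<)

  e-refl : ∀ x → e x x ≡ 0
  e-refl x = cong up (d-refl _ (clamp< x))

  e-sym : ∀ x y → e x y ≡ e y x
  e-sym x y = cong up (d-sym _ _ (clamp< x) (clamp< y))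

  e-tri : ∀ x y z → e x z ≤ e x y + e y z
  e-tri x y z = up-+ {d (clamp x) (clamp y)} {d (clamp y) (clamp z)} (d-tri _ _ _ (clamp< x) (clamp< y) (clamp< z))

  e-pos : ∀ {x y} → x < 2 * n → y < 2 * n → x ≢ y → 1 ≤ e x y
  e-pos x< y< x≢y = subst (1 ≤_) (sym (e-id x< y<)) (up-pos (d-≥1 _ _ x< y< x≢y))

  open Analysis e e-refl e-sym e-tri n e-pos

  out : ℕ → List Edge
  out t = output (stateAt e t)

  -- At each time the rounded revealed distances agree with the one fixed metric `e` on the arrived
  -- terminals, so the whole run can be analysed with `e`.
  revealed : ∀ {t} → t ≤ n → AgreeOn (terms 0 t) (round (reveal t d)) e
  revealed {t} t≤n x∈ y∈ rewrite <ᵇ-true⁺ (proj₂ (∈-terms⁻ x∈)) | <ᵇ-true⁺ (proj₂ (∈-terms⁻ y∈)) =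
    sym (e-id (<-≤-trans (proj₂ (∈-terms⁻ x∈)) (*-monoʳ-≤ 2 t≤n)) (<-≤-trans (proj₂ (∈-terms⁻ y∈)) (*-monoʳ-≤ 2 t≤n)))

  run≡ : ∀ t → t ≤ n → run algorithm d t ≡ solution (stateAt e t)
  run≡ zero    _   = toSet-[]
  run≡ (suc t) t<n = algorithm-online (suc t) {reveal (suc t) d} {e} (revealed t<n)

  out-within : ∀ t → Within (_< 2 * t) (out t)
  out-within t = output-within (range-stateAt e t)

  feasible : ∀ t → t ≤ n → Feasible t (run algorithm d t)
  feasible t t≤n i i<t = subst (λ E → Conn t E (2 * i) (suc (2 * i))) (sym (run≡ t t≤n))
    (toSet-conn (out-within t) (output-serves (Inv.phase (proj₁ (run-invariant t t≤n))) i<t))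

  cost-≤ : ∀ t → t ≤ n → cost d t (toSet (out t)) ℚ.≤ ι (price e (out t))
  cost-≤ t t≤n = ℚ.≤-trans
    (sumℚ-≤ (2 * t) (λ y _ → sumℚ-≤ y (λ x _ → pointwise x y)))
    (ι-mono (sum₂-≤ (2 * t) (edgeAt t (toSet (out t))) (len e) e-sym (out t)
      (λ x y eq → let lt , _ , ∈out = edgeAt⁻ t (toSet (out t)) x y eq in lt , toSet⁻ (out t) x y ∈out)))
    where
    pointwise : ∀ x y → (if edgeAt t (toSet (out t)) x y then d x y else 0ℚ) ℚ.≤ ι (if edgeAt t (toSet (out t)) x y then e x y else 0)
    pointwise x y with edgeAt t (toSet (out t)) x y in eq
    ... | false = ι-mono {0} {0} z≤n
    ... | true  = let lt , lt′ , _ = edgeAt⁻ t (toSet (out t)) x y eq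
                      y< = <-≤-trans lt′ (*-monoʳ-≤ 2 t≤n)
                  in subst (λ m → d x y ℚ.≤ ι m) (sym (e-id (<-trans lt y<) y<)) (up-≥ (d x y))

  cost-≥ : ∀ t → t ≤ n → ∀ G → ι (price e (fromSet t G)) ℚ.≤ cost d t G ℚ.+ cost d t G
  cost-≥ t t≤n G = ℚ.≤-trans (ℚ.≤-reflexive (cong ι (rows-cost e t G (2 * t))))
    (sumℚ-double (2 * t) (λ y _ → sumℚ-double y (λ x _ → pointwise x y)))
    where
    pointwise : ∀ x y → ι (if edgeAt t G x y then e x y else 0)
                        ℚ.≤ (if edgeAt t G x y then d x y else 0ℚ) ℚ.+ (if edgeAt t G x y then d x y else 0ℚ)
    pointwise x y with edgeAt t G x y in eq
    ... | false = ι-mono {0} {0} z≤n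
    ... | true  = let lt , lt′ , _ = edgeAt⁻ t G x y eq
                      y< = <-≤-trans lt′ (*-monoʳ-≤ 2 t≤n)
                      x< = <-trans lt y<
                  in subst (λ m → ι m ℚ.≤ d x y ℚ.+ d x y) (sym (e-id x< y<)) (up-double (d-≥1 x y x< y< (<⇒≢ lt)))

  -- 144 = 18 · 4 · 2: the output costs at most 18 `ref`, `ref` is at most 4 times any solution by
  -- `opt-approx`, and rounding at most doubles that solution.
  competitive : ∀ t → t ≤ n → ∀ G → Feasible t G → cost d t (run algorithm d t) ℚ.≤ 144 · cost d t G
  competitive t t≤n G feasibleG = begin
    cost d t (run algorithm d t)  ≡⟨ cong (cost d t) (run≡ t t≤n) ⟩
    cost d t (toSet (out t))      ≤⟨ cost-≤ t t≤n ⟩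
    ι (price e (out t))                 ≤⟨ ι-mono integral ⟩
    ι (72 * price e F)                  ≡⟨ ι-* 72 (price e F) ⟩
    ι 72 ℚ.* ι (price e F)              ≤⟨ ℚ.*-monoˡ-≤-nonNeg (ι 72) (cost-≥ t t≤n G) ⟩
    ι 72 ℚ.* (c ℚ.+ c)                 ≡⟨ ℚ.*-distribˡ-+ (ι 72) c c ⟩
    ι 72 ℚ.* c ℚ.+ ι 72 ℚ.* c          ≡⟨ ℚ.*-distribʳ-+ c (ι 72) (ι 72) ⟨
    (ι 72 ℚ.+ ι 72) ℚ.* c              ≡⟨⟩
    144 · c                       ∎
    where
    open ℚ.≤-Reasoning
    c = cost d t G
    F = fromSet t G
    I = proj₁ (run-invariant t t≤n)
    solves : Solves t F
    solves = within-map ∈-downFrom⁺ (rows-within t G (2 * t)) , λ i<t → fromSet-conn (feasibleG _ i<t)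
    integral : price e (out t) ≤ 72 * price e F
    integral = let t₀ , t₀≤t , ref≤ = Inv.ref-opt I in
      ≤-trans (cost-output (Inv.phase I) (Inv.small I))
        (≤-trans (*-monoʳ-≤ 18 (≤-trans ref≤ (opt-approx t₀≤t solves))) (≤-reflexive (sym (*-assoc 18 4 (price e F)))))

  recourse-≤ : ∀ {t b} → t ≤ n → Edits e t b → recourse algorithm d t ≤ b
  recourse-≤ t≤n zero               = z≤n
  recourse-≤ t≤n (suc {t} E edit) = +-mono-≤ (recourse-≤ (<⇒≤ t≤n) E)
    (changes-≤ {algorithm} {d} {t} {l = out t} {out (suc t)} (run≡ t (<⇒≤ t≤n)) (run≡ (suc t) t≤n) (out-within t) (out-within (suc t)) edit)

  recourse-bound : recourse algorithm d n ≤ 2860 * (n * (1 + ⌊log₂ n ⌋))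
  recourse-bound = let I , b , rb , E , B = run-invariant n ≤-refl in begin
    recourse algorithm d n             ≤⟨ recourse-≤ ≤-refl E ⟩
    b                                  ≤⟨ edits-≤ ≤-refl (Inv.phase I) (Inv.bounded I) (Inv.positive I) B ⟩
    rate * n                           ≡⟨ cong (_* n) rate≡ ⟩
    2860 * Λ * n                       ≡⟨ *-assoc 2860 Λ n ⟩
    2860 * (Λ * n)                     ≡⟨ cong (2860 *_) (*-comm Λ n) ⟩
    2860 * (n * (1 + ⌊log₂ n ⌋))       ∎
    where open ≤-Reasoning

theorem1p1 : Σ OnlineAlg λ A → ∃₂ λ (α C : ℕ) →
    ∀ (n : ℕ) (d : Dist) → IsTerminalMetric n d →
    (∀ t → 1 ≤ t → t ≤ n →
    Feasible t (run A d t) ×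
    (∀ (G : EdgeSet) → Feasible t G → cost d t (run A d t) ≤ℚ (α · cost d t G)))
    × recourse A d n ≤ C * (n * (1 + ⌊log₂ n ⌋))
theorem1p1 = algorithm , 144 , 2860 , λ where
  -- Without pairs there is no terminal 0 to clamp to, so this case is separate: no time `t`
  -- qualifies, and the recourse is an empty sum.
  zero    d metric → (λ t 1≤t t≤0 → ⊥-elim (<⇒≱ 1≤t t≤0)) , z≤n
  (suc n) d metric →
    (λ t _ t≤n → Guarantee.feasible (suc n) (s≤s z≤n) d metric t t≤n ,
                 Guarantee.competitive (suc n) (s≤s z≤n) d metric t t≤n) ,
    Guarantee.recourse-bound (suc n) (s≤s z≤n) d metric
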